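{- A depth-first search (DFS) of a directed or undirected graph $G$ with $n$ vertices and $m$ edges can be carried out in $O(n+m)$ time with at most $n+\frac{4}{5}m+O(\log n)$ bits of working memory.
   Context: $\log$ denotes $\log_2$. Model of computation: word RAM with word length $\Omega(\log n)$ bits and constant-time standard word operations; the input is read-only, the output (if any) is write-only, and space is the number of bits of working memory, not counting input and output. Input representation: the vertex set is $V=\{1,\ldots,n\}$ for a known integer $n\ge 1$. For an undirected graph, the constant-time access functions are: $\mathrm{deg}(u)$, the degree of $u\in V$; for $u\in V$ and $i\in\{0,\ldots,\mathrm{deg}(u)-1\}$, $\mathrm{head}(u,i)$, the $(i+1)$st neighbor $v$ of $u$ in some arbitrary fixed ordering of the neighbors of $u$, and $\mathrm{mate}(u,i)$, the integer $j$ with $\mathrm{head}(v,j)=u$. A directed graph is represented with in/out adjacency arrays, i.e., the inneighbors as well as the outneighbors of each vertex can be accessed one by one, and there are cross links: for each edge $(u,v)$, the function $\mathrm{mate}$ maps in constant time the position of $v$ in the adjacency array of $u$ to that of $u$ in the adjacency array of $v$ and vice versa. A DFS visits all vertices and edges of $G$. Vertices are initially white, become gray when discovered, and turn black when all their incident edges (outgoing edges, if $G$ is directed) have been explored. At the outermost level the DFS steps through the vertices in some order (the root order) and starts a new tree at each vertex not yet discovered. It obeys the DFS rule: whenever two or more discovered vertices have unexplored incident (out)edges, an (out)edge incident on the most recently discovered such vertex (the current vertex) is explored first; if it leads to a white vertex $w$, then $w$ is discovered and becomes the current vertex. Carrying out a DFS means executing such a traversal, invoking user procedures at the appropriate events (a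 vertex turning gray or black; exploration of an edge from the current vertex, distinguishing whether or not it leads to a new vertex; withdrawal over a tree edge). The resources of the user procedures themselves are not counted. -}

module Defs where

open import Data.Bool using (Bool; true; false; if_then_else_; _∧_; _∨_; _xor_)
open import Data.Fin using (Fin; toℕ; fromℕ<)
import Data.Fin.Properties as Fin
open import Data.List using (List; []; _∷_; _++_; map; sum; length; filter; allFin)
open import Data.List.Membership.Propositional using (_∈_; _∉_)
open import Data.List.Relation.Binary.Permutation.Propositional using (_↭_)
open import Data.Maybe using (Maybe; just; nothing; _>>=_)
open import Data.Nat
open import Data.Nat.DivMod using (_/_; _%_)
open import Data.Nat.Logarithm using (⌈log₂_⌉)
open import Data.Nat.Properties using (m^n≢0)
open import Data.Product using (Σ; Σ-syntax; ∃-syntax; _×_; _,_)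
open import Data.Vec using (Vec; lookup; replicate; _[_]≔_)
open import Function.Definitions using (Injective)
open import Relation.Binary.PropositionalEquality using (_≡_; _≢_)
open import Relation.Nullary using (yes; no)

record Adjacency (n : ℕ) : Set where
  field
    deg  : Fin n → ℕ
    head : (u : Fin n) → Fin (deg u) → Fin n

-- An undirected simple graph, with an arbitrary ordering of the neighbors
-- of each vertex.
record UndirectedGraph (n : ℕ) : Set where
  field
    deg       : Fin n → ℕ
    head      : (u : Fin n) → Fin (deg u) → Fin n
    mate      : (u : Fin n) (i : Fin (deg u)) → Fin (deg (head u i))
    head-mate : ∀ u i → head (head u i) (mate u i) ≡ u
    simple    : ∀ u → Injective _≡_ _≡_ (head u)
    loopless  : ∀ u i → head u i ≢ u

  adjacency : Adjacency n
  adjacency = record { deg = deg ; head = head }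

  -- An edge {u , v} is counted once, at its smaller endpoint.
  edgeCount : ℕ
  edgeCount =
    sum (map (λ u → length (filter (λ i → u Fin.<? head u i) (allFin (deg u))))
             (allFin n))

-- A directed graph with edge set E ⊆ V × V (antiparallel edges and self-loops
-- are possible, parallel edges are not), with arbitrary orderings of the
-- outneighbors and of the inneighbors of each vertex.  outmate and inmate are
-- the cross links between the two arrays.
record DirectedGraph (n : ℕ) : Set where
  field
    outdeg       : Fin n → ℕ
    indeg        : Fin n → ℕ
    outhead      : (u : Fin n) → Fin (outdeg u) → Fin n
    inhead       : (v : Fin n) → Fin (indeg v) → Fin n
    outmate      : (u : Fin n) (i : Fin (outdeg u)) → Fin (indeg (outhead u i))
    inmate       : (v : Fin n) (j : Fin (indeg v)) → Fin (outdeg (inhead v j))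
    head-outmate : ∀ u i → inhead (outhead u i) (outmate u i) ≡ u
    head-inmate  : ∀ v j → outhead (inhead v j) (inmate v j) ≡ v
    out-simple   : ∀ u → Injective _≡_ _≡_ (outhead u)
    in-simple    : ∀ v → Injective _≡_ _≡_ (inhead v)

  adjacency : Adjacency n
  adjacency = record { deg = outdeg ; head = outhead }

  edgeCount : ℕ
  edgeCount = sum (map outdeg (allFin n))

data VertexProc : Set where
  turnsGray turnsBlack : VertexProc

-- An edge is named by a vertex u and a position i in the (out-)adjacency array
-- of u; with v = head(u,i), the three events are: exploration of the edge from
-- the current vertex u when v is white, the same when v is not white, and
-- withdrawal over the tree edge from v back to u.
data EdgeProc : Set where
  exploreToNew exploreToOld withdraw : EdgeProc

-- Events carry numbers as a program sees them: vertices are 1, …, n, positions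
-- start at 0.
data Event : Set where
  vertexEvent : VertexProc → ℕ → Event
  edgeEvent   : EdgeProc → ℕ → ℕ → Event

label : ∀ {n} → Fin n → ℕ
label u = suc (toℕ u)

data Color : Set where
  white gray black : Color

module DFS {n : ℕ} (A : Adjacency n) where
  open Adjacency A

  -- In the undirected case {u , v} yields the two arcs (u , v) and (v , u):
  -- the edge is explored from either endpoint, while that endpoint is current.
  Arc : Set
  Arc = Σ[ u ∈ Fin n ] Fin (deg u)

  onVertex : VertexProc → Fin n → Event
  onVertex p u = vertexEvent p (label u)

  onArc : EdgeProc → Arc → Event
  onArc p (u , i) = edgeEvent p (label u) (toℕ i)

  -- path holds the gray vertices, the most recently discovered one (the current
  -- vertex) first, each with the tree edge leading to it (nothing for a root).
  -- Vertices discovered earlier but no longer on the path are black and have no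
  -- unexplored arcs, so taking arcs only from the top is the DFS rule.
  record State : Set where
    constructor state
    field
      roots    : List (Fin n)
      color    : Vec Color n
      explored : List Arc
      path     : List (Fin n × Maybe Arc)

  withdrawal : Maybe Arc → List Event
  withdrawal (just a) = onArc withdraw a ∷ []
  withdrawal nothing  = []

  data Step : State → List Event → State → Set where
    skipRoot : ∀ {r rs col ex} → lookup col r ≢ white →
      Step (state (r ∷ rs) col ex []) [] (state rs col ex [])
    newRoot : ∀ {r rs col ex} → lookup col r ≡ white →
      Step (state (r ∷ rs) col ex [])
           (onVertex turnsGray r ∷ [])
           (state rs (col [ r ]≔ gray) ex ((r , nothing) ∷ []))
    toNew : ∀ {rs col ex u p path} (i : Fin (deg u)) →
      (u , i) ∉ ex → lookup col (head u i) ≡ white →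
      Step (state rs col ex ((u , p) ∷ path))
           (onArc exploreToNew (u , i) ∷ onVertex turnsGray (head u i) ∷ [])
           (state rs (col [ head u i ]≔ gray) ((u , i) ∷ ex)
                  ((head u i , just (u , i)) ∷ (u , p) ∷ path))
    toOld : ∀ {rs col ex u p path} (i : Fin (deg u)) →
      (u , i) ∉ ex → lookup col (head u i) ≢ white →
      Step (state rs col ex ((u , p) ∷ path))
           (onArc exploreToOld (u , i) ∷ [])
           (state rs col ((u , i) ∷ ex) ((u , p) ∷ path))
    finish : ∀ {rs col ex u p path} → (∀ i → (u , i) ∈ ex) →
      Step (state rs col ex ((u , p) ∷ path))
           (onVertex turnsBlack u ∷ withdrawal p)
           (state rs (col [ u ]≔ black) ex path)

  data Steps : State → List Event → State → Set where
    []  : ∀ {s} → Steps s [] s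
    _∷_ : ∀ {s s′ s″ es es′} →
      Step s es s′ → Steps s′ es′ s″ → Steps s (es ++ es′) s″

  initial : List (Fin n) → State
  initial ρ = state ρ (replicate n white) [] []

  -- The event sequences of complete traversals; ρ is the root order.
  IsDFS : List Event → Set
  IsDFS es =
    ∃[ ρ ] ∃[ col ] ∃[ ex ]
      ρ ↭ allFin n × Steps (initial ρ) es (state [] col ex [])

-- Names of the constant-time access functions of one and of two arguments;
-- in an Input they are undefined outside their domain.
record Signature : Set₁ where
  field
    Access₁ Access₂ : Set

record Input (S : Signature) : Set where
  open Signature S
  field
    size    : ℕ
    access₁ : Access₁ → ℕ → Maybe ℕ
    access₂ : Access₂ → ℕ → ℕ → Maybe ℕ

toFin : (d x : ℕ) → Maybe (Fin d)
toFin d x with x <? d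
... | yes x<d = just (fromℕ< x<d)
... | no  _   = nothing

toVertex : (n x : ℕ) → Maybe (Fin n)
toVertex n zero    = nothing
toVertex n (suc x) = toFin n x

module _ {n : ℕ} where

  onVertices : (Fin n → ℕ) → ℕ → Maybe ℕ
  onVertices f x = toVertex n x >>= λ u → just (f u)

  onEntries : (d : Fin n → ℕ) → ((u : Fin n) → Fin (d u) → ℕ) → ℕ → ℕ → Maybe ℕ
  onEntries d f x y =
    toVertex n x >>= λ u → toFin (d u) y >>= λ i → just (f u i)

data UAccess₁ : Set where
  deg : UAccess₁

data UAccess₂ : Set where
  head mate : UAccess₂

undirected : Signature
undirected = record { Access₁ = UAccess₁ ; Access₂ = UAccess₂ }

undirectedInput : ∀ {n} → UndirectedGraph n → Input undirected
undirectedInput {n} G = record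
  { size    = n
  ; access₁ = λ { deg → onVertices G.deg }
  ; access₂ = λ { head → onEntries G.deg (λ u i → label (G.head u i))
                ; mate → onEntries G.deg (λ u i → toℕ (G.mate u i)) }
  } where module G = UndirectedGraph G

data DAccess₁ : Set where
  outdeg indeg : DAccess₁

data DAccess₂ : Set where
  outhead inhead outmate inmate : DAccess₂

directed : Signature
directed = record { Access₁ = DAccess₁ ; Access₂ = DAccess₂ }

directedInput : ∀ {n} → DirectedGraph n → Input directed
directedInput {n} G = record
  { size    = n
  ; access₁ = λ { outdeg → onVertices G.outdeg
                ; indeg  → onVertices G.indeg }
  ; access₂ = λ { outhead → onEntries G.outdeg (λ u i → label (G.outhead u i))
                ; inhead  → onEntries G.indeg  (λ v j → label (G.inhead v j))
                ; outmate → onEntries G.outdeg (λ u i → toℕ (G.outmate u i))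
                ; inmate  → onEntries G.indeg  (λ v j → toℕ (G.inmate v j)) }
  } where module G = DirectedGraph G

data Operand (k : ℕ) : Set where
  reg   : Fin k → Operand k
  const : ℕ → Operand k
  size  : Operand k

data Op : Set where
  add sub mul div mod shl shr and or xor eq lt : Op

-- Exactly one operation per expression, so that an assignment has unit cost.
data Expr (S : Signature) (k : ℕ) : Set where
  val     : Operand k → Expr S k
  op      : Op → Operand k → Operand k → Expr S k
  access₁ : Signature.Access₁ S → Operand k → Expr S k
  access₂ : Signature.Access₂ S → Operand k → Operand k → Expr S k
  -- load a ℓ: the number stored in the ℓ memory bits starting at bit a
  load    : Operand k → Operand k → Expr S k

infixr 4 _⨾_

data Program (S : Signature) (k : ℕ) : Set where
  skip  : Program S k
  _⨾_   : Program S k → Program S k → Program S k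
  _:=_  : Fin k → Expr S k → Program S k
  -- store a ℓ x: put the ℓ low-order bits of x into memory starting at bit a
  store : Operand k → Operand k → Operand k → Program S k
  cond  : Operand k → Program S k → Program S k → Program S k
  while : Operand k → Program S k → Program S k
  call₁ : VertexProc → Operand k → Program S k
  call₂ : EdgeProc → Operand k → Operand k → Program S k

bitAt : ℕ → ℕ → Bool
bitAt x zero    = x % 2 ≡ᵇ 1
bitAt x (suc i) = bitAt (x / 2) i

fromBool : Bool → ℕ
fromBool b = if b then 1 else 0

bitwise : (Bool → Bool → Bool) → ℕ → ℕ → ℕ → ℕ
bitwise f zero    x y = 0
bitwise f (suc w) x y =
  fromBool (f (bitAt x 0) (bitAt y 0)) + 2 * bitwise f w (x / 2) (y / 2)

wrap : (w x : ℕ) → ℕ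
wrap w x = _%_ x (2 ^ w) {{m^n≢0 2 w}}

evalOp : (w : ℕ) → Op → ℕ → ℕ → Maybe ℕ
evalOp w add x y       = just (wrap w (x + y))
evalOp w sub x y       = just (wrap w (x + (2 ^ w ∸ y)))
evalOp w mul x y       = just (wrap w (x * y))
evalOp w div x zero    = nothing
evalOp w div x (suc y) = just (x / suc y)
evalOp w mod x zero    = nothing
evalOp w mod x (suc y) = just (x % suc y)
evalOp w shl x y       = just (wrap w (x * 2 ^ y))
evalOp w shr x y       = just (_/_ x (2 ^ y) {{m^n≢0 2 y}})
evalOp w and x y       = just (bitwise _∧_ w x y)
evalOp w or  x y       = just (bitwise _∨_ w x y)
evalOp w xor x y       = just (bitwise _xor_ w x y)
evalOp w eq  x y       = just (fromBool (x ≡ᵇ y))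
evalOp w lt  x y       = just (fromBool (x <ᵇ y))

Memory : Set
Memory = ℕ → Bool

readBits : Memory → (a ℓ : ℕ) → ℕ
readBits μ a zero    = 0
readBits μ a (suc ℓ) = fromBool (μ a) + 2 * readBits μ (suc a) ℓ

writeBits : Memory → (a ℓ x : ℕ) → Memory
writeBits μ a ℓ x p =
  if (a ≤ᵇ p) ∧ (p <ᵇ a + ℓ) then bitAt x (p ∸ a) else μ p

record Config (k : ℕ) : Set where
  constructor config
  field
    registers : Vec ℕ k
    memory    : Memory

-- w is the word length, M the number of memory bits and b the number of bits
-- of each register.  Memory is addressed by bits: a field of at most w bits
-- at an arbitrary position lies in at most two machine words, so an access to
-- it is a constant number of word accesses, shifts and masks.  Charging b bits
-- for a register (b ≤ w below), rather than w, makes a bound of O(log n) bits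
-- meaningful for word lengths that are not O(log n).  Leaving the M memory bits
-- or exceeding b bits in a register is an error: no execution exists.
module Machine {S : Signature} (I : Input S) {k : ℕ} (w b M : ℕ) where
  private module I = Input I

  value : Config k → Operand k → ℕ
  value (config ρ μ) (reg r)   = lookup ρ r
  value _            (const c) = wrap w c
  value _            size      = I.size

  InMemory : (a ℓ : ℕ) → Set
  InMemory a ℓ = ℓ ≤ w × a + ℓ ≤ M

  data Eval (s : Config k) : Expr S k → ℕ → Set where
    val : ∀ {o} → Eval s (val o) (value s o)
    op  : ∀ {f o₁ o₂ z} → evalOp w f (value s o₁) (value s o₂) ≡ just z →
      Eval s (op f o₁ o₂) z
    access₁ : ∀ {f o z} → I.access₁ f (value s o) ≡ just z →
      Eval s (access₁ f o) z
    access₂ : ∀ {f o₁ o₂ z} → I.access₂ f (value s o₁) (value s o₂) ≡ just z →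
      Eval s (access₂ f o₁ o₂) z
    load : ∀ {a ℓ} → InMemory (value s a) (value s ℓ) →
      Eval s (load a ℓ)
             (readBits (Config.memory s) (value s a) (value s ℓ))

  -- Exec P s t es s′: started in s, the program P stops in s′ after t time
  -- units, having made the sequence es of calls of user procedures.
  data Exec : Program S k → Config k → ℕ → List Event → Config k → Set where
    skip : ∀ {s} → Exec skip s 1 [] s
    _⨾_ : ∀ {P Q s s′ s″ t t′ es es′} →
      Exec P s t es s′ → Exec Q s′ t′ es′ s″ →
      Exec (P ⨾ Q) s (t + t′) (es ++ es′) s″
    assign : ∀ {r e ρ μ z} → Eval (config ρ μ) e z → z < 2 ^ b →
      Exec (r := e) (config ρ μ) 1 [] (config (ρ [ r ]≔ z) μ)
    store : ∀ {a ℓ x ρ μ} (let v = value (config ρ μ)) →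
      InMemory (v a) (v ℓ) →
      Exec (store a ℓ x) (config ρ μ) 1 []
           (config ρ (writeBits μ (v a) (v ℓ) (v x)))
    cond-true : ∀ {o P Q s s′ t es} → value s o ≢ 0 →
      Exec P s t es s′ → Exec (cond o P Q) s (suc t) es s′
    cond-false : ∀ {o P Q s s′ t es} → value s o ≡ 0 →
      Exec Q s t es s′ → Exec (cond o P Q) s (suc t) es s′
    while-true : ∀ {o P s s′ s″ t t′ es es′} → value s o ≢ 0 →
      Exec P s t es s′ → Exec (while o P) s′ t′ es′ s″ →
      Exec (while o P) s (suc (t + t′)) (es ++ es′) s″
    while-false : ∀ {o P s} → value s o ≡ 0 → Exec (while o P) s 1 [] s
    call₁ : ∀ {f o s} →
      Exec (call₁ f o) s 1 (vertexEvent f (value s o) ∷ []) s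
    call₂ : ∀ {f o₁ o₂ s} →
      Exec (call₂ f o₁ o₂) s 1
           (edgeEvent f (value s o₁) (value s o₂) ∷ []) s

start : ∀ {k} → Config k
start {k} = config (replicate k 0) (λ _ → false)

-- With word length w and on input I, the program P carries out a DFS of the
-- graph with (out-)adjacency arrays A, in t time units and with at most s bits
-- of working memory.
CarriesOutDFS : ∀ {S k n} → Program S k → Input S → Adjacency n →
                (w t s : ℕ) → Set
CarriesOutDFS {k = k} P I A w t s =
  ∃[ b ] ∃[ M ] ∃[ es ] ∃[ end ]
    b ≤ w × k * b + M ≤ s ×
    Machine.Exec I w b M P start t es end × DFS.IsDFS A es

-- The argument of all O(log n) and Ω(log n); the 1 matters only for n = 1,
-- where log n = 0.
lg : ℕ → ℕ
lg n = 1 + ⌈log₂ n ⌉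

-- When the edge in position i of the array of u leads to a new vertex v, the position p of
-- u in the array of v determines, through the cross links, both u and i.  So to return
-- from v it suffices to know p, and the search resumes at position i + 1 of u.  Hence only
-- the position of the parent of each gray vertex has to be remembered.  The positions of
-- the current vertex and of the root need no space, and the others form a stack, which is
-- kept behind the n bits that distinguish the white vertices.
--
-- In an undirected graph, a gray vertex of degree d below the top of the stack has its
-- parent and its child in different positions, so one of d − 1 values is stored.  If
-- d ∉ {4 , 6 , 7}, then ⌊2d/5⌋ bits hold such a value; for each of the remaining d, groups
-- of five values are written in radix d − 1 with 2d bits, incomplete groups waiting in a
-- register.  Since the degrees add up to 2m, the stack takes at most 4m/5 bits.  In a
-- directed graph a vertex is treated as one with d = 2·indeg, and the indegrees add up
-- to m.
--
-- Each iteration of the search explores an edge or finishes a vertex, in constant time.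
module Submission where

open import Defs
  hiding (deg; head; mate; outdeg; indeg; outhead; inhead; outmate; inmate; eq; lt)
open import Data.Bool using (Bool; true; false; T; if_then_else_)
open import Data.Bool.Properties using (T-≡)
open import Data.Empty using (⊥-elim)
open import Data.Fin using (Fin; zero; suc; toℕ; fromℕ<; #_)
import Data.Fin.Properties as Fin
open import Data.List using (List; []; _∷_; _++_; map; length; filter; allFin; tabulate; concatMap)
import Data.List.Properties as List
open import Data.List.Membership.Propositional using (_∈_; _∉_)
open import Data.List.Membership.Propositional.Properties
  using (∈-map⁺; ∈-map⁻; ∈-++⁺ˡ; ∈-++⁺ʳ; ∈-++⁻; ∈-∃++; ∈-filter⁺; ∈-filter⁻; ∈-allFin)
open import Data.List.Relation.Binary.Permutation.Propositional using (↭-refl)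
open import Data.List.Relation.Unary.All using (All; []; _∷_)
import Data.List.Relation.Unary.All as All
import Data.List.Relation.Unary.All.Properties as All
open import Data.List.Relation.Unary.AllPairs using ([]; _∷_)
open import Data.List.Relation.Unary.Any using (here; there)
open import Data.List.Relation.Unary.Unique.Propositional using (Unique)
import Data.List.Relation.Unary.Unique.Propositional.Properties as Unique
open import Data.Maybe using (Maybe; just; nothing)
open import Data.Nat
open import Data.Nat.Divisibility using (divides-refl)
open import Data.Nat.DivMod hiding (_div_; _mod_)
open import Data.Nat.Induction using (Acc; acc; <-wellFounded)
open import Data.Nat.ListAction using (sum)
open import Data.Nat.Logarithm using (⌈log₂_⌉; ⌈log₂⌉-mono-≤; ⌈log₂2^n⌉≡n; ⌈log₂⌈n/2⌉⌉≡⌈log₂n⌉∸1)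
open import Data.Nat.Properties
open import Data.Nat.Tactic.RingSolver using (solve-∀)
open import Data.Product using (Σ; ∃-syntax; Σ-syntax; _×_; _,_; proj₁; proj₂)
open import Data.Sum using (_⊎_; inj₁; inj₂)
open import Data.Unit using (⊤; tt)
open import Data.Vec using (Vec; []; _∷_; lookup; replicate; _[_]≔_)
open import Data.Vec.Properties using (lookup∘update; lookup∘update′; lookup-replicate)
open import Function using (_∘_; id)
open import Function.Bundles using (Equivalence)
open import Relation.Binary.Definitions using (tri<; tri≈; tri>)
open import Relation.Binary.PropositionalEquality
open import Relation.Nullary using (¬_; Dec; yes; no; does; contradiction)
open import Relation.Nullary.Decidable using (toWitness; True)

-- Bits of memory

-- The obstacle is rounding. A frame with d - 1 possible values has a budget of 2d/5 bits, and the
-- integer ⌊2d/5⌋ suffices except for d = 4, 6, 7, where 3, 5, 6 values meet 1, 2, 2 bits. Over five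
-- frames with the same d nothing is lost: 3^5 ≤ 2^8, 5^5 ≤ 2^12, 6^5 ≤ 2^14. Frames with different
-- d interleave, so each of these d has an accumulator of its own. Popping remains possible: if the
-- top frame has such a d and its accumulator is empty, the block on top of the memory is the one to
-- reload. Space is measured in fifths of a bit. A digit waiting in an accumulator is worth 2d,
-- hence every push raises the measure by at most 2d, and a block is fully paid for when it is
-- written. For large d even ⌊2d/5⌋ may exceed the word length. The width of a field is therefore
-- capped by the bit length of n, which the program computes at the start. One search program serves
-- both kinds of graph: an undirected graph is viewed as a directed one with antiparallel edges, and
-- apart from the names of the access functions, only the computation of d and the coding of a
-- position depend on the kind.

bit-<2 : ∀ b → fromBool b < 2
bit-<2 true  = s≤s (s≤s z≤n)
bit-<2 false = s≤s z≤n

bitAt-zero : ∀ x → fromBool (bitAt x 0) ≡ x % 2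
bitAt-zero x with x % 2 | m%n<n x 2
... | 0 | _ = refl
... | 1 | _ = refl
... | suc (suc _) | s≤s (s≤s ())

/2-< : ∀ {x e} → x < 2 ^ suc e → x / 2 < 2 ^ e
/2-< {x} {e} x< = m<n*o⇒m/o<n (subst (x <_) (*-comm 2 (2 ^ e)) x<)

readBits-bitAt : ∀ (μ : Memory) a ℓ x → x < 2 ^ ℓ →
  (∀ i → i < ℓ → μ (a + i) ≡ bitAt x i) → readBits μ a ℓ ≡ x
readBits-bitAt μ a zero    x x< _    = sym (n≤0⇒n≡0 (s≤s⁻¹ x<))
readBits-bitAt μ a (suc ℓ) x x< bits = begin
  fromBool (μ a) + 2 * readBits μ (suc a) ℓ
    ≡⟨ cong₂ (λ p q → fromBool p + 2 * q)
         (trans (cong μ (sym (+-identityʳ a))) (bits 0 (s≤s z≤n)))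
         (readBits-bitAt μ (suc a) ℓ (x / 2) (/2-< {e = ℓ} x<)
           (λ i i< → trans (cong μ (sym (+-suc a i))) (bits (suc i) (s≤s i<)))) ⟩
  fromBool (bitAt x 0) + 2 * (x / 2)
    ≡⟨ cong₂ _+_ (bitAt-zero x) (*-comm 2 (x / 2)) ⟩
  x % 2 + x / 2 * 2
    ≡⟨ m≡m%n+[m/n]*n x 2 ⟨
  x ∎
  where open ≡-Reasoning

readBits-cong : ∀ {μ μ′ : Memory} a ℓ →
  (∀ q → a ≤ q → q < a + ℓ → μ′ q ≡ μ q) → readBits μ′ a ℓ ≡ readBits μ a ℓ
readBits-cong a zero    _    = refl
readBits-cong a (suc ℓ) same = cong₂ (λ p q → fromBool p + 2 * q)
  (same a ≤-refl (subst (a <_) (sym (+-suc a ℓ)) (s≤s (m≤m+n a ℓ))))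
  (readBits-cong (suc a) ℓ λ q a<q q< →
    same q (<⇒≤ a<q) (subst (q <_) (sym (+-suc a ℓ)) q<))

≤ᵇ-true : ∀ {m n} → m ≤ n → (m ≤ᵇ n) ≡ true
≤ᵇ-true = Equivalence.to T-≡ ∘ ≤⇒≤ᵇ

<ᵇ-true : ∀ {m n} → m < n → (m <ᵇ n) ≡ true
<ᵇ-true = Equivalence.to T-≡ ∘ <⇒<ᵇ

¬T-false : ∀ {b} → ¬ T b → b ≡ false
¬T-false {true}  ¬t = ⊥-elim (¬t tt)
¬T-false {false} _  = refl

<ᵇ-false : ∀ {m n} → n ≤ m → (m <ᵇ n) ≡ false
<ᵇ-false {m} {n} n≤m = ¬T-false (≤⇒≯ n≤m ∘ <ᵇ⇒< m n)

≡ᵇ-true : ∀ {m n} → m ≡ n → (m ≡ᵇ n) ≡ true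
≡ᵇ-true {m} {n} = Equivalence.to T-≡ ∘ ≡⇒≡ᵇ m n

≡ᵇ-false : ∀ {m n} → m ≢ n → (m ≡ᵇ n) ≡ false
≡ᵇ-false {m} {n} m≢n = ¬T-false (m≢n ∘ ≡ᵇ⇒≡ m n)

writeBits-inside : ∀ μ a ℓ x i → i < ℓ → writeBits μ a ℓ x (a + i) ≡ bitAt x i
writeBits-inside μ a ℓ x i i<ℓ
  rewrite ≤ᵇ-true (m≤m+n a i) | <ᵇ-true (+-monoʳ-< a i<ℓ) | m+n∸m≡n a i = refl

writeBits-below : ∀ μ a ℓ x q → q < a → writeBits μ a ℓ x q ≡ μ q
writeBits-below μ a ℓ x q q<a
  rewrite ¬T-false {a ≤ᵇ q} (<⇒≱ q<a ∘ ≤ᵇ⇒≤ a q) = refl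

writeBits-above : ∀ μ a ℓ x q → a + ℓ ≤ q → writeBits μ a ℓ x q ≡ μ q
writeBits-above μ a ℓ x q a+ℓ≤q
  rewrite ≤ᵇ-true (≤-trans (m≤m+n a ℓ) a+ℓ≤q) | <ᵇ-false a+ℓ≤q = refl

readBits-writeBits : ∀ μ a ℓ x → x < 2 ^ ℓ → readBits (writeBits μ a ℓ x) a ℓ ≡ x
readBits-writeBits μ a ℓ x x< =
  readBits-bitAt _ a ℓ x x< (writeBits-inside μ a ℓ x)

-- Sums over the vertices and counting of edges

Σ[_] : ∀ {n} → (Fin n → ℕ) → ℕ
Σ[_] {n} f = sum (map f (allFin n))

Σ-suc : ∀ {n} (f : Fin (suc n) → ℕ) → Σ[ f ] ≡ f zero + Σ[ f ∘ suc ]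
Σ-suc f = cong (λ xs → f zero + sum xs)
  (trans (List.map-tabulate suc f) (sym (List.map-tabulate id (f ∘ suc))))

Σ-mono : ∀ {n} {f g : Fin n → ℕ} → (∀ x → g x ≤ f x) → Σ[ g ] ≤ Σ[ f ]
Σ-mono {zero}              g≤f = z≤n
Σ-mono {suc n} {f} {g} g≤f = begin
  Σ[ g ]                    ≡⟨ Σ-suc g ⟩
  g zero + Σ[ g ∘ suc ]     ≤⟨ +-mono-≤ (g≤f zero) (Σ-mono (g≤f ∘ suc)) ⟩
  f zero + Σ[ f ∘ suc ]     ≡⟨ Σ-suc f ⟨
  Σ[ f ]                    ∎
  where open ≤-Reasoning

-- Isolates one vertex of a sum. It serves to split off a single term and to show that a potential
-- drops when it decreases at one vertex and grows nowhere.
Σ-gap : ∀ {n} {f g : Fin n → ℕ} x c → (∀ y → y ≢ x → g y ≤ f y) →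
  c + g x ≤ f x → c + Σ[ g ] ≤ Σ[ f ]
Σ-gap {suc n} {f} {g} zero c g≤f gap = begin
  c + Σ[ g ]                    ≡⟨ cong (c +_) (Σ-suc g) ⟩
  c + (g zero + Σ[ g ∘ suc ])   ≡⟨ +-assoc c _ _ ⟨
  c + g zero + Σ[ g ∘ suc ]     ≤⟨ +-mono-≤ gap (Σ-mono λ y → g≤f (suc y) λ ()) ⟩
  f zero + Σ[ f ∘ suc ]         ≡⟨ Σ-suc f ⟨
  Σ[ f ]                        ∎
  where open ≤-Reasoning
Σ-gap {suc n} {f} {g} (suc x) c g≤f gap = begin
  c + Σ[ g ]                    ≡⟨ cong (c +_) (Σ-suc g) ⟩
  c + (g zero + Σ[ g ∘ suc ])   ≡⟨ swap c (g zero) _ ⟩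
  g zero + (c + Σ[ g ∘ suc ])
    ≤⟨ +-mono-≤ (g≤f zero λ ())
         (Σ-gap x c (λ y y≢x → g≤f (suc y) (y≢x ∘ Fin.suc-injective)) gap) ⟩
  f zero + Σ[ f ∘ suc ]         ≡⟨ Σ-suc f ⟨
  Σ[ f ]                        ∎
  where
  open ≤-Reasoning
  swap : ∀ a b c → a + (b + c) ≡ b + (a + c)
  swap = solve-∀

infixl 6 _[_↦_]

_[_↦_] : ∀ {n} {A : Set} → (Fin n → A) → Fin n → A → Fin n → A
(f [ x ↦ a ]) y = if does (y Fin.≟ x) then a else f y

↦-at : ∀ {n} {A : Set} (f : Fin n → A) x a → (f [ x ↦ a ]) x ≡ a
↦-at f x a with x Fin.≟ x
... | yes _  = refl
... | no x≢x = contradiction refl x≢x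

↦-other : ∀ {n} {A : Set} (f : Fin n → A) {x} a {y} → y ≢ x → (f [ x ↦ a ]) y ≡ f y
↦-other f {x} a {y} y≢x with y Fin.≟ x
... | yes y≡x = contradiction y≡x y≢x
... | no _    = refl

-- Once the term of `x` has been taken, `f` is set to 0 at `x`; this leaves the remaining terms
-- unchanged because `x` does not occur again.
Σ-unique : ∀ {n} (f : Fin n → ℕ) {xs} → Unique xs → sum (map f xs) ≤ Σ[ f ]
Σ-unique f [] = z≤n
Σ-unique f {x ∷ xs} (x∉xs ∷ unique) = begin
  f x + sum (map f xs)
    ≡⟨ cong (λ ys → f x + sum ys)
         (List.map-cong-local (All.map (λ x≢y → sym (↦-other f 0 (x≢y ∘ sym))) x∉xs)) ⟩
  f x + sum (map f′ xs)
    ≤⟨ +-monoʳ-≤ (f x) (Σ-unique f′ unique) ⟩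
  f x + Σ[ f′ ]
    ≤⟨ Σ-gap x (f x) (λ y y≢x → ≤-reflexive (↦-other f 0 y≢x))
         (≤-reflexive (trans (cong (f x +_) (↦-at f x 0)) (+-identityʳ (f x)))) ⟩
  Σ[ f ] ∎
  where
  open ≤-Reasoning
  f′ = f [ x ↦ 0 ]

Σ-const : ∀ {n} (f : Fin n → ℕ) c → (∀ x → f x ≤ c) → Σ[ f ] ≤ n * c
Σ-const {zero}  f c f≤c = z≤n
Σ-const {suc n} f c f≤c = ≤-trans (≤-reflexive (Σ-suc f))
  (+-mono-≤ (f≤c zero) (Σ-const (f ∘ suc) c (f≤c ∘ suc)))

Σ-+ : ∀ {n} (f g : Fin n → ℕ) → Σ[ (λ x → f x + g x) ] ≡ Σ[ f ] + Σ[ g ]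
Σ-+ {zero}  f g = refl
Σ-+ {suc n} f g = begin
  Σ[ (λ x → f x + g x) ]                                ≡⟨ Σ-suc (λ x → f x + g x) ⟩
  f zero + g zero + Σ[ (λ x → f (suc x) + g (suc x)) ]
    ≡⟨ cong (f zero + g zero +_) (Σ-+ (f ∘ suc) (g ∘ suc)) ⟩
  f zero + g zero + (Σ[ f ∘ suc ] + Σ[ g ∘ suc ])       ≡⟨ shuffle (f zero) _ _ _ ⟩
  f zero + Σ[ f ∘ suc ] + (g zero + Σ[ g ∘ suc ])
    ≡⟨ cong₂ _+_ (Σ-suc f) (Σ-suc g) ⟨
  Σ[ f ] + Σ[ g ]                                       ∎
  where
  open ≡-Reasoning
  shuffle : ∀ a b c d → a + b + (c + d) ≡ a + c + (b + d)
  shuffle = solve-∀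

-- The image of the first element is deleted from `ys`; by injectivity and uniqueness the other
-- images survive the deletion. Edges are counted with this comparison in place of bijections.
length-≤-injective : ∀ {A B : Set} (f : A → B) → (∀ {x y} → f x ≡ f y → x ≡ y) →
  ∀ {xs} (ys : List B) → Unique xs → (∀ {x} → x ∈ xs → f x ∈ ys) → length xs ≤ length ys
length-≤-injective f inj ys [] _ = z≤n
length-≤-injective f inj {x ∷ xs} ys (x∉xs ∷ unique) into
  with ∈-∃++ (into (here refl))
... | ys₁ , ys₂ , refl = begin
  suc (length xs)               ≤⟨ s≤s (length-≤-injective f inj (ys₁ ++ ys₂) unique into′) ⟩
  suc (length (ys₁ ++ ys₂))     ≡⟨ cong suc (List.length-++ ys₁) ⟩
  suc (length ys₁ + length ys₂) ≡⟨ +-suc (length ys₁) (length ys₂) ⟨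
  length ys₁ + suc (length ys₂) ≡⟨ List.length-++ ys₁ ⟨
  length (ys₁ ++ f x ∷ ys₂)     ∎
  where
  open ≤-Reasoning
  into′ : ∀ {y} → y ∈ xs → f y ∈ ys₁ ++ ys₂
  into′ {y} y∈xs with ∈-++⁻ ys₁ (into (there y∈xs))
  ... | inj₁ fy∈ys₁          = ∈-++⁺ˡ fy∈ys₁
  ... | inj₂ (there fy∈ys₂)  = ∈-++⁺ʳ ys₁ fy∈ys₂
  ... | inj₂ (here fy≡fx)    = contradiction (inj (sym fy≡fx)) (All.lookup x∉xs y∈xs)

-- Adjacency entries as pairs, and double counting of edges

module _ {n : ℕ} {d : Fin n → ℕ} (select : ∀ u → List (Fin (d u))) where

  row : (u : Fin n) → List (Σ (Fin n) (Fin ∘ d))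
  row u = map (u ,_) (select u)

  pairs : List (Fin n) → List (Σ (Fin n) (Fin ∘ d))
  pairs = concatMap row

  length-pairs : ∀ us → length (pairs us) ≡ sum (map (length ∘ select) us)
  length-pairs []       = refl
  length-pairs (u ∷ us) = trans (List.length-++ (row u))
    (cong₂ _+_ (List.length-map _ (select u)) (length-pairs us))

  ∈-pairs⁺ : ∀ {u i us} → u ∈ us → i ∈ select u → (u , i) ∈ pairs us
  ∈-pairs⁺ (here refl) i∈          = ∈-++⁺ˡ (∈-map⁺ _ i∈)
  ∈-pairs⁺ {us = v ∷ _} (there u∈) i∈ = ∈-++⁺ʳ (row v) (∈-pairs⁺ u∈ i∈)

  ∈-pairs⁻ : ∀ {a} us → a ∈ pairs us → proj₁ a ∈ us × proj₂ a ∈ select (proj₁ a)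
  ∈-pairs⁻ (u ∷ us) a∈ with ∈-++⁻ (row u) a∈
  ... | inj₂ a∈us with ∈-pairs⁻ us a∈us
  ...   | u∈ , i∈ = there u∈ , i∈
  ∈-pairs⁻ (u ∷ us) a∈ | inj₁ a∈row with ∈-map⁻ _ a∈row
  ...   | _ , i∈ , refl = here refl , i∈

  pairs-unique : (∀ u → Unique (select u)) → ∀ {us} → Unique us → Unique (pairs us)
  pairs-unique rows [] = []
  pairs-unique rows {u ∷ us} (u∉us ∷ unique) =
    Unique.++⁺ (Unique.map⁺ (λ { refl → refl }) (rows u)) (pairs-unique rows unique) disjoint
    where
    disjoint : ∀ {a} → ¬ (a ∈ row u × a ∈ pairs us)
    disjoint (a∈row , a∈us) with ∈-map⁻ _ a∈row
    ... | _ , _ , refl = All.lookup u∉us (proj₁ (∈-pairs⁻ us a∈us)) refl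

length-filter-split : ∀ {A : Set} {P Q : A → Set} (P? : ∀ x → Dec (P x)) (Q? : ∀ x → Dec (Q x)) →
  (∀ x → P x ⊎ Q x) → ∀ xs → length xs ≤ length (filter P? xs) + length (filter Q? xs)
length-filter-split P? Q? P∪Q []       = z≤n
length-filter-split P? Q? P∪Q (x ∷ xs) with P? x | Q? x | length-filter-split P? Q? P∪Q xs
... | yes _ | yes _ | ih = s≤s (≤-trans ih (+-monoʳ-≤ _ (n≤1+n _)))
... | yes _ | no _  | ih = s≤s ih
... | no _  | yes _ | ih = subst (suc (length xs) ≤_) (sym (+-suc _ _)) (s≤s ih)
... | no ¬p | no ¬q | _  with P∪Q x
...   | inj₁ p = contradiction p ¬p
...   | inj₂ q = contradiction q ¬q

-- Each edge of an undirected graph becomes two antiparallel edges.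
bidirected : ∀ {n} → UndirectedGraph n → DirectedGraph n
bidirected G = record
  { outdeg = deg ; indeg = deg ; outhead = head ; inhead = head
  ; outmate = mate ; inmate = mate ; head-outmate = head-mate ; head-inmate = head-mate
  ; out-simple = simple ; in-simple = simple }
  where open UndirectedGraph G

module _ {n : ℕ} (D : DirectedGraph n) where
  open DirectedGraph D

  arc-≡ : ∀ {u v : Fin n} {i : Fin (outdeg u)} {j : Fin (outdeg v)} →
    u ≡ v → outhead u i ≡ outhead v j → (u , i) ≡ (v , j)
  arc-≡ {u} refl eq = cong (u ,_) (out-simple u eq)

  -- The cross links are only assumed to lead to the right vertices. That a round trip also restores
  -- the position follows because different positions of `u` have different heads.
  reverse-≡ : ∀ u i → (inhead _ (outmate u i) , inmate _ (outmate u i)) ≡ (u , i)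
  reverse-≡ u i = arc-≡ (head-outmate u i) (head-inmate _ (outmate u i))

  outdeg≤n : ∀ u → outdeg u ≤ n
  outdeg≤n u = Fin.injective⇒≤ (out-simple u)

  indeg≤n : ∀ u → indeg u ≤ n
  indeg≤n u = Fin.injective⇒≤ (in-simple u)

  edgeCount≤n*n : edgeCount ≤ n * n
  edgeCount≤n*n = Σ-const outdeg n outdeg≤n

module _ {n : ℕ} (D : DirectedGraph n) where
  open DirectedGraph D

  inArc-≡ : ∀ {u v : Fin n} {i : Fin (indeg u)} {j : Fin (indeg v)} →
    u ≡ v → inhead u i ≡ inhead v j → (u , i) ≡ (v , j)
  inArc-≡ {u} refl eq = cong (u ,_) (in-simple u eq)

  -- Following the cross link from an inneighbor entry to its outgoing edge is injective: the edge
  -- determines its head `v` and its tail, and the tail determines the position in the array of `v`.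
  Σindeg≤edgeCount : Σ[ indeg ] ≤ edgeCount
  Σindeg≤edgeCount = subst₂ _≤_ (count indeg) (count outdeg)
    (length-≤-injective forward injective (pairs all (allFin n))
      (pairs-unique all (λ u → Unique.allFin⁺ _) (Unique.allFin⁺ n))
      (λ _ → ∈-pairs⁺ all (∈-allFin _) (∈-allFin _)))
    where
    all : ∀ {d : Fin n → ℕ} u → List (Fin (d u))
    all {d} u = allFin (d u)

    count : ∀ d → length (pairs {d = d} all (allFin n)) ≡ Σ[ d ]
    count d = trans (length-pairs {d = d} all (allFin n))
      (cong sum (List.map-cong (λ u → List.length-tabulate {n = d u} id) (allFin n)))

    forward : Σ (Fin n) (Fin ∘ indeg) → Σ (Fin n) (Fin ∘ outdeg)
    forward (v , j) = inhead v j , inmate v j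

    outhead′ : Σ (Fin n) (Fin ∘ outdeg) → Fin n
    outhead′ (u , i) = outhead u i

    injective : ∀ {a b} → forward a ≡ forward b → a ≡ b
    injective {v , j} {v′ , j′} eq = inArc-≡
      (trans (sym (head-inmate v j)) (trans (cong outhead′ eq) (head-inmate v′ j′)))
      (cong proj₁ eq)

module _ {n : ℕ} (G : UndirectedGraph n) where
  open UndirectedGraph G

  private
    up down : ∀ u → List (Fin (deg u))
    up   u = filter (λ i → u Fin.<? head u i) (allFin (deg u))
    down u = filter (λ i → head u i Fin.<? u) (allFin (deg u))

    opposite : Σ (Fin n) (Fin ∘ deg) → Σ (Fin n) (Fin ∘ deg)
    opposite (u , i) = head u i , mate u i

    opposite-involutive : ∀ a → opposite (opposite a) ≡ a
    opposite-involutive (u , i) = reverse-≡ (bidirected G) u i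

    -- Reversal is an involution, hence injective, and turns entries that lead to smaller vertices
    -- into entries that lead to larger ones.
    Σdown≤Σup : Σ[ length ∘ down ] ≤ Σ[ length ∘ up ]
    Σdown≤Σup = subst₂ _≤_ (length-pairs down (allFin n)) (length-pairs up (allFin n))
      (length-≤-injective opposite injective (pairs up (allFin n))
        (pairs-unique down (λ u → Unique.filter⁺ _ (Unique.allFin⁺ _)) (Unique.allFin⁺ n))
        into)
      where
      injective : ∀ {a b} → opposite a ≡ opposite b → a ≡ b
      injective {a} {b} eq = trans (sym (opposite-involutive a))
        (trans (cong opposite eq) (opposite-involutive b))

      into : ∀ {a} → a ∈ pairs down (allFin n) → opposite a ∈ pairs up (allFin n)
      into {u , i} a∈ = ∈-pairs⁺ up (∈-allFin _)
        (∈-filter⁺ _ (∈-allFin _)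
          (subst (λ v → toℕ (head u i) < toℕ v) (sym (head-mate u i))
            (proj₂ (∈-filter⁻ (λ i → head u i Fin.<? u) {xs = allFin (deg u)}
              (proj₂ (∈-pairs⁻ down (allFin n) a∈))))))

  -- Without loops every entry leads up or down in the order of the vertices. The entries leading up
  -- are those that `edgeCount` counts.
  Σdeg≤2*edgeCount : Σ[ deg ] ≤ 2 * edgeCount
  Σdeg≤2*edgeCount = begin
    Σ[ deg ]                                      ≤⟨ Σ-mono split ⟩
    Σ[ (λ u → length (up u) + length (down u)) ]  ≡⟨ Σ-+ (length ∘ up) (length ∘ down) ⟩
    edgeCount + Σ[ length ∘ down ]                ≤⟨ +-monoʳ-≤ edgeCount Σdown≤Σup ⟩
    edgeCount + edgeCount                         ≡⟨ cong (edgeCount +_) (+-identityʳ edgeCount) ⟨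
    2 * edgeCount                                 ∎
    where
    open ≤-Reasoning
    differ : ∀ u i → toℕ u < toℕ (head u i) ⊎ toℕ (head u i) < toℕ u
    differ u i with <-cmp (toℕ u) (toℕ (head u i))
    ... | tri< lt _ _ = inj₁ lt
    ... | tri≈ _ eq _ = contradiction (sym (Fin.toℕ-injective eq)) (loopless u i)
    ... | tri> _ _ gt = inj₂ gt
    split : ∀ u → deg u ≤ length (up u) + length (down u)
    split u = subst (_≤ length (up u) + length (down u)) (List.length-tabulate {n = deg u} id)
      (length-filter-split (λ i → u Fin.<? head u i) (λ i → head u i Fin.<? u)
        (differ u) (allFin (deg u)))

-- The machine and the programs

module Execution {S : Signature} (I : Input S) (k w b M : ℕ) (b≤w : b ≤ w) (32≤2^b : 32 ≤ 2 ^ b) where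
  open Machine I {k} w b M public

  private instance
    2^w≢0 : NonZero (2 ^ w)
    2^w≢0 = m^n≢0 2 w

  widen : ∀ {z} → z < 2 ^ b → z < 2 ^ w
  widen z< = <-≤-trans z< (^-monoʳ-≤ 2 b≤w)

  wrap-small : ∀ {z} → z < 2 ^ b → wrap w z ≡ z
  wrap-small z< = m<n⇒m%n≡m (widen z<)

  -- Machine constants are reduced modulo 2^w. All those in the programs are below 32, so a single
  -- bound on `b` covers them, and the side condition is found by evaluation.
  constant : ∀ c {_ : True (c <? 32)} → wrap w c ≡ c
  constant c {c<} = wrap-small (<-≤-trans (toWitness c<) 32≤2^b)

  small : ∀ c {_ : True (c <? 32)} → c < 2 ^ b
  small c {c<} = <-≤-trans (toWitness c<) 32≤2^b

  module _ {ρ : Vec ℕ k} {μ : Memory} where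
    private
      s = config ρ μ

    Assigns : Fin k → Expr S k → ℕ → Set
    Assigns r e z = Exec (r := e) s 1 [] (config (ρ [ r ]≔ z) μ)

    set : ∀ {r o x} → value s o ≡ x → x < 2 ^ b → Assigns r (val o) x
    set refl x< = assign val x<

    set-add : ∀ {r o₁ o₂ x y z} → value s o₁ ≡ x → value s o₂ ≡ y → x + y ≡ z → z < 2 ^ b →
      Assigns r (op add o₁ o₂) z
    set-add refl refl refl z< = assign (op (cong just (wrap-small z<))) z<

    set-mul : ∀ {r o₁ o₂ x y z} → value s o₁ ≡ x → value s o₂ ≡ y → x * y ≡ z → z < 2 ^ b →
      Assigns r (op mul o₁ o₂) z
    set-mul refl refl refl z< = assign (op (cong just (wrap-small z<))) z<

    -- The premise `y + z ≡ x` states that there is no borrow: the machine adds 2^w - y, which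
    -- yields z + 2^w and wraps to `z`.
    set-sub : ∀ {r o₁ o₂ x y z} → value s o₁ ≡ x → value s o₂ ≡ y → y + z ≡ x → x < 2 ^ b →
      Assigns r (op sub o₁ o₂) z
    set-sub {o₁ = o₁} {o₂} {z = z} refl refl y+z≡x x< = assign (op (cong just (begin
      wrap w (x + (2 ^ w ∸ y))        
        ≡⟨ cong (λ v → wrap w (v + (2 ^ w ∸ y))) (sym (trans (+-comm z y) y+z≡x)) ⟩
      wrap w (z + y + (2 ^ w ∸ y))    ≡⟨ cong (wrap w) (+-assoc z y _) ⟩
      wrap w (z + (y + (2 ^ w ∸ y)))  ≡⟨ cong (λ v → wrap w (z + v)) (m+[n∸m]≡n y≤2^w) ⟩
      wrap w (z + 2 ^ w)              ≡⟨ [m+n]%n≡m%n z (2 ^ w) ⟩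
      wrap w z                        ≡⟨ wrap-small z< ⟩
      z                               ∎))) z<
      where
      open ≡-Reasoning
      x = value s o₁
      y = value s o₂
      z< : z < 2 ^ b
      z< = ≤-<-trans (m+n≤o⇒n≤o y (≤-reflexive y+z≡x)) x<
      y≤2^w : y ≤ 2 ^ w
      y≤2^w = <⇒≤ (widen (≤-<-trans (m+n≤o⇒m≤o y (≤-reflexive y+z≡x)) x<))

    set-div : ∀ {r o₁ o₂ x y z} → value s o₁ ≡ x → value s o₂ ≡ suc y → x / suc y ≡ z → z < 2 ^ b →
      Assigns r (op div o₁ o₂) z
    set-div {o₁ = o₁} refl y≡ refl z< =
      assign (op (cong (evalOp w div (value s o₁)) y≡)) z<

    set-mod : ∀ {r o₁ o₂ x y z} → value s o₁ ≡ x → value s o₂ ≡ suc y → x % suc y ≡ z → z < 2 ^ b →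
      Assigns r (op mod o₁ o₂) z
    set-mod {o₁ = o₁} refl y≡ refl z< =
      assign (op (cong (evalOp w mod (value s o₁)) y≡)) z<

    set-eq-yes : ∀ {r o₁ o₂ x y} → value s o₁ ≡ x → value s o₂ ≡ y → x ≡ y →
      Assigns r (op Op.eq o₁ o₂) 1
    set-eq-yes refl refl x≡y = assign (op (cong (just ∘ fromBool) (≡ᵇ-true x≡y))) (small 1)

    set-eq-no : ∀ {r o₁ o₂ x y} → value s o₁ ≡ x → value s o₂ ≡ y → x ≢ y →
      Assigns r (op Op.eq o₁ o₂) 0
    set-eq-no refl refl x≢y = assign (op (cong (just ∘ fromBool) (≡ᵇ-false x≢y))) (small 0)

    set-lt : ∀ {r o₁ o₂ x y} → value s o₁ ≡ x → value s o₂ ≡ y →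
      Assigns r (op Op.lt o₁ o₂) (fromBool (x <ᵇ y))
    set-lt {x = x} {y} refl refl =
      assign (op refl) (<-≤-trans (bit-<2 (x <ᵇ y)) (≤-trans (s≤s (s≤s z≤n)) 32≤2^b))

    set-lt-yes : ∀ {r o₁ o₂ x y} → value s o₁ ≡ x → value s o₂ ≡ y → x < y →
      Assigns r (op Op.lt o₁ o₂) 1
    set-lt-yes refl refl x<y = assign (op (cong (just ∘ fromBool) (<ᵇ-true x<y))) (small 1)

    set-lt-no : ∀ {r o₁ o₂ x y} → value s o₁ ≡ x → value s o₂ ≡ y → y ≤ x →
      Assigns r (op Op.lt o₁ o₂) 0
    set-lt-no refl refl y≤x = assign (op (cong (just ∘ fromBool) (<ᵇ-false y≤x))) (small 0)

    set-load : ∀ {r o₁ o₂ a ℓ z} → value s o₁ ≡ a → value s o₂ ≡ ℓ → InMemory a ℓ →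
      readBits μ a ℓ ≡ z → z < 2 ^ b → Assigns r (load o₁ o₂) z
    set-load refl refl inside refl z< = assign (load inside) z<

    set-access₁ : ∀ {r f o x z} → value s o ≡ x → Input.access₁ I f x ≡ just z → z < 2 ^ b →
      Assigns r (access₁ f o) z
    set-access₁ refl z≡ z< = assign (access₁ z≡) z<

    set-access₂ : ∀ {r f o₁ o₂ x y z} → value s o₁ ≡ x → value s o₂ ≡ y →
      Input.access₂ I f x y ≡ just z → z < 2 ^ b → Assigns r (access₂ f o₁ o₂) z
    set-access₂ refl refl z≡ z< = assign (access₂ z≡) z<

    put : ∀ {o₁ o₂ o₃ a ℓ x} → value s o₁ ≡ a → value s o₂ ≡ ℓ → value s o₃ ≡ x → InMemory a ℓ →
      Exec (store o₁ o₂ o₃) s 1 [] (config ρ (writeBits μ a ℓ x))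
    put refl refl refl inside = store inside

registerCount : ℕ
registerCount = 19

Code : Signature → Set
Code S = Program S registerCount

-- u is the current vertex, p the position in u's inneighbor array of the tree
-- edge leading to u, j the position of the next outgoing edge of u, and r the
-- root of the current tree.
u# p# j# r# t# v# sp# W# d# x# y# A# C# a4# c4# a6# c6# a7# c7# : Fin registerCount
u#  = # 0
p#  = # 1
j#  = # 2
r#  = # 3
t#  = # 4
v#  = # 5
sp# = # 6
W#  = # 7
d#  = # 8
x#  = # 9
y#  = # 10
A#  = # 11
C#  = # 12
a4# = # 13
c4# = # 14
a6# = # 15
c6# = # 16
a7# = # 17
c7# = # 18

module Stacks {S : Signature} where

  accPush accPop directWidth directPush directPop packedPush packedPop : Code S
  accPush =
    y# := op sub (reg d#) (const 1) ⨾
    A# := op mul (reg A#) (reg y#) ⨾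
    A# := op add (reg A#) (reg x#) ⨾
    C# := op add (reg C#) (const 1) ⨾
    y# := op Op.eq (reg C#) (const 5) ⨾
    cond (reg y#)
      (y# := op add (reg d#) (reg d#) ⨾
       store (reg sp#) (reg y#) (reg A#) ⨾
       sp# := op add (reg sp#) (reg y#) ⨾
       A# := val (const 0) ⨾
       C# := val (const 0))
      skip
  accPop =
    -- By the stack discipline, a frame pushed with this `d` while no digit waits is the last digit
    -- of a block, and all that was stored after this block has been removed. The reloaded
    -- accumulator has five digits.
    cond (reg C#)
      skip
      (y# := op add (reg d#) (reg d#) ⨾
       sp# := op sub (reg sp#) (reg y#) ⨾
       A# := load (reg sp#) (reg y#) ⨾
       C# := val (const 5)) ⨾
    y# := op sub (reg d#) (const 1) ⨾
    x# := op mod (reg A#) (reg y#) ⨾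
    A# := op div (reg A#) (reg y#) ⨾
    C# := op sub (reg C#) (const 1)
  directWidth =
    y# := op add (reg d#) (reg d#) ⨾
    y# := op div (reg y#) (const 5) ⨾
    t# := op Op.lt (reg W#) (reg y#) ⨾
    cond (reg t#) (y# := val (reg W#)) skip
  directPush =
    directWidth ⨾
    store (reg sp#) (reg y#) (reg x#) ⨾
    sp# := op add (reg sp#) (reg y#)
  directPop =
    directWidth ⨾
    sp# := op sub (reg sp#) (reg y#) ⨾
    x# := load (reg sp#) (reg y#)

  -- with the accumulator held in the registers a and c
  withAcc : Fin registerCount → Fin registerCount → Code S → Code S
  withAcc a c P =
    A# := val (reg a) ⨾ C# := val (reg c) ⨾ P ⨾ a := val (reg A#) ⨾ c := val (reg C#)

  byKey : (P Q : Code S) → Code S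
  byKey P Q =
    t# := op Op.eq (reg d#) (const 4) ⨾
    cond (reg t#) (withAcc a4# c4# P)
      (t# := op Op.eq (reg d#) (const 6) ⨾
       cond (reg t#) (withAcc a6# c6# P)
         (t# := op Op.eq (reg d#) (const 7) ⨾
          cond (reg t#) (withAcc a7# c7# P) Q))
  packedPush = byKey accPush directPush
  packedPop  = byKey accPop directPop

-- The stack holds, for each gray vertex that is neither the root of its tree nor
-- current, a number x less than d − 1: encode computes x from the parent position p
-- and the position j of the tree edge to the next gray vertex, decode recovers p
-- from x and j, and key computes d from the vertex alone.
record Interface (S : Signature) : Set where
  field
    outdeg : Signature.Access₁ S
    outhead inhead outmate inmate : Signature.Access₂ S
    key encode decode : Code S

module Traversal {S : Signature} (F : Interface S) where
  open Interface F
  open Stacks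

  pushFrame popFrame exploreArc retreat visit search countBit dfs : Code S
  pushFrame = key ⨾ encode ⨾ packedPush
  popFrame  = key ⨾ packedPop ⨾ decode

  exploreArc =
    v# := access₂ outhead (reg u#) (reg j#) ⨾
    t# := load (reg v#) (const 1) ⨾
    cond (reg t#)
      (call₂ exploreToOld (reg u#) (reg j#) ⨾
       j# := op add (reg j#) (const 1) ⨾
       t# := val (const 1))
      (call₂ exploreToNew (reg u#) (reg j#) ⨾
       call₁ turnsGray (reg v#) ⨾
       store (reg v#) (const 1) (const 1) ⨾
       t# := op Op.eq (reg u#) (reg r#) ⨾
       cond (reg t#) skip pushFrame ⨾
       p# := access₂ outmate (reg u#) (reg j#) ⨾
       u# := val (reg v#) ⨾
       j# := val (const 0) ⨾
       t# := val (const 1))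

  retreat =
    call₁ turnsBlack (reg u#) ⨾
    t# := op Op.eq (reg u#) (reg r#) ⨾
    cond (reg t#)
      (t# := val (const 0))
      (v# := access₂ inhead (reg u#) (reg p#) ⨾
       j# := access₂ inmate (reg u#) (reg p#) ⨾
       u# := val (reg v#) ⨾
       call₂ withdraw (reg u#) (reg j#) ⨾
       t# := op Op.eq (reg u#) (reg r#) ⨾
       cond (reg t#) skip popFrame ⨾
       j# := op add (reg j#) (const 1) ⨾
       t# := val (const 1))

  visit =
    v# := access₁ outdeg (reg u#) ⨾
    t# := op Op.lt (reg j#) (reg v#) ⨾
    cond (reg t#) exploreArc retreat

  search =
    r# := op add (reg r#) (const 1) ⨾
    t# := load (reg r#) (const 1) ⨾
    cond (reg t#)
      skip
      (store (reg r#) (const 1) (const 1) ⨾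
       call₁ turnsGray (reg r#) ⨾
       u# := val (reg r#) ⨾
       j# := val (const 0) ⨾
       t# := val (const 1) ⨾
       while (reg t#) visit) ⨾
    t# := op Op.lt (reg r#) size

  countBit =
    v# := op div (reg v#) (const 2) ⨾
    W# := op add (reg W#) (const 1)

  dfs =
    v# := val size ⨾
    while (reg v#) countBit ⨾
    -- Vertices are numbered from 1, so the marks occupy bits 1 to n, bit 0 stays free, and the
    -- stack begins at bit n + 1.
    sp# := op add size (const 1) ⨾
    t# := op Op.lt (reg r#) size ⨾
    while (reg t#) search

-- The packed stack

n<2^n : ∀ n → n < 2 ^ n
n<2^n zero    = s≤s z≤n
n<2^n (suc n) = begin-strict
  suc n          <⟨ s≤s (n<2^n n) ⟩
  1 + 2 ^ n      ≤⟨ +-monoˡ-≤ (2 ^ n) (m^n>0 2 n) ⟩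
  2 ^ n + 2 ^ n  ≡⟨ cong (2 ^ n +_) (+-identityʳ (2 ^ n)) ⟨
  2 ^ suc n      ∎
  where open ≤-Reasoning

Packed Direct : ℕ → Set
Packed d = d ≡ 4 ⊎ d ≡ 6 ⊎ d ≡ 7
Direct d = ¬ Packed d

-- The cap `W`, the bit length of n in the program, keeps a field within a register for large `d`.
-- It loses nothing, as the stored positions are less than n.
width : (W d : ℕ) → ℕ
width W d = (d + d) / 5 ⊓ W

5*width≤ : ∀ W d → 5 * width W d ≤ d + d
5*width≤ W d = begin
  5 * width W d        ≤⟨ *-monoʳ-≤ 5 (m⊓n≤m ((d + d) / 5) W) ⟩
  5 * ((d + d) / 5)    ≡⟨ *-comm 5 ((d + d) / 5) ⟩
  (d + d) / 5 * 5      ≤⟨ m/n*n≤m (d + d) 5 ⟩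
  d + d                ∎
  where open ≤-Reasoning

-- Raising d by 5 raises the exponent by exactly 2. The power is thereby quadrupled, and since it
-- was at least 7, it grows by more than 5; the five residues start from d = 8 to 12.
direct-large : ∀ e → 8 + e ≤ suc (2 ^ (((8 + e) + (8 + e)) / 5))
direct-large 0 = ≤ᵇ⇒≤ _ _ tt
direct-large 1 = ≤ᵇ⇒≤ _ _ tt
direct-large 2 = ≤ᵇ⇒≤ _ _ tt
direct-large 3 = ≤ᵇ⇒≤ _ _ tt
direct-large 4 = ≤ᵇ⇒≤ _ _ tt
direct-large (suc (suc (suc (suc (suc e))))) = begin
  5 + (8 + e)                ≤⟨ +-monoʳ-≤ 5 (direct-large e) ⟩
  5 + suc P                  ≡⟨ +-suc 5 P ⟩
  suc (5 + P)                ≤⟨ s≤s (+-monoˡ-≤ P 5≤3P) ⟩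
  suc (3 * P + P)            ≡⟨ cong suc (quadruple P) ⟩
  suc (2 ^ (2 + k))          ≡⟨ cong (suc ∘ (2 ^_)) step ⟨
  suc (2 ^ (((13 + e) + (13 + e)) / 5)) ∎
  where
  open ≤-Reasoning
  k P : ℕ
  k = ((8 + e) + (8 + e)) / 5
  P = 2 ^ k
  quadruple : ∀ P → 3 * P + P ≡ 2 * (2 * P)
  quadruple = solve-∀
  5≤3P : 5 ≤ 3 * P
  5≤3P = ≤-trans (≤ᵇ⇒≤ 5 21 tt)
    (*-monoʳ-≤ 3 (s≤s⁻¹ (≤-trans (m≤m+n 8 e) (direct-large e))))
  regroup : ∀ e → (13 + e) + (13 + e) ≡ 2 * 5 + ((8 + e) + (8 + e))
  regroup = solve-∀
  step : ((13 + e) + (13 + e)) / 5 ≡ 2 + k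
  step = trans (cong (_/ 5) (regroup e)) (+-distrib-/-∣ˡ ((8 + e) + (8 + e)) {5} (divides-refl 2))

direct-fits : ∀ d → Direct d → d ≤ suc (2 ^ ((d + d) / 5))
direct-fits 0 _ = z≤n
direct-fits 1 _ = s≤s z≤n
direct-fits 2 _ = ≤ᵇ⇒≤ _ _ tt
direct-fits 3 _ = ≤ᵇ⇒≤ _ _ tt
direct-fits 4 direct = contradiction (inj₁ refl) direct
direct-fits 5 _ = ≤ᵇ⇒≤ _ _ tt
direct-fits 6 direct = contradiction (inj₂ (inj₁ refl)) direct
direct-fits 7 direct = contradiction (inj₂ (inj₂ refl)) direct
direct-fits (suc (suc (suc (suc (suc (suc (suc (suc e)))))))) _ = direct-large e

<2^width : ∀ {W d x} → Direct d → suc x < d → x < 2 ^ W → x < 2 ^ width W d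
<2^width {W} {d} direct x+1<d x<2^W with ⊓-sel ((d + d) / 5) W
... | inj₁ eq rewrite eq = s≤s⁻¹ (<-≤-trans x+1<d (direct-fits d direct))
... | inj₂ eq rewrite eq = x<2^W

-- Five digits A₄…A₀ in radix q = d − 1 are moved to the memory as one block of
-- 2d bits; fewer digits are kept in the accumulator A, with their number in C.
data AccPush (μ : Memory) (q x : ℕ) : (sp A C sp′ A′ C′ : ℕ) → Set where
  part : ∀ {sp A C} → C < 4 → AccPush μ q x sp A C sp (A * q + x) (suc C)
  full : ∀ {sp A} → readBits μ sp (suc q + suc q) ≡ A * q + x →
    AccPush μ q x sp A 4 (sp + (suc q + suc q)) 0 0

-- The vector holds the accumulator and its number of digits for d = 4, 6 and 7, in this order. `μ`
-- is the memory after the push, described only by what can be read back.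
data Push (μ : Memory) (W : ℕ) : (d x sp : ℕ) → Vec ℕ 6 → (sp′ : ℕ) → Vec ℕ 6 → Set where
  at4 : ∀ {x sp A C sp′ A′ C′ a₆ c₆ a₇ c₇} → AccPush μ 3 x sp A C sp′ A′ C′ →
    Push μ W 4 x sp (A ∷ C ∷ a₆ ∷ c₆ ∷ a₇ ∷ c₇ ∷ []) sp′ (A′ ∷ C′ ∷ a₆ ∷ c₆ ∷ a₇ ∷ c₇ ∷ [])
  at6 : ∀ {x sp A C sp′ A′ C′ a₄ c₄ a₇ c₇} → AccPush μ 5 x sp A C sp′ A′ C′ →
    Push μ W 6 x sp (a₄ ∷ c₄ ∷ A ∷ C ∷ a₇ ∷ c₇ ∷ []) sp′ (a₄ ∷ c₄ ∷ A′ ∷ C′ ∷ a₇ ∷ c₇ ∷ [])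
  at7 : ∀ {x sp A C sp′ A′ C′ a₄ c₄ a₆ c₆} → AccPush μ 6 x sp A C sp′ A′ C′ →
    Push μ W 7 x sp (a₄ ∷ c₄ ∷ a₆ ∷ c₆ ∷ A ∷ C ∷ []) sp′ (a₄ ∷ c₄ ∷ a₆ ∷ c₆ ∷ A′ ∷ C′ ∷ [])
  direct : ∀ {d x sp a} → Direct d → readBits μ sp (width W d) ≡ x →
    Push μ W d x sp a (sp + width W d) a

-- The layout is specified by the history of the pushes that are still in force. A pop is then the
-- inversion of the last constructor, and no decoding of the interleaved blocks and fields is ever
-- defined.
data Stack (n : ℕ) (μ : Memory) (W : ℕ) : ℕ → Vec ℕ 6 → List (ℕ × ℕ) → Set where
  []   : Stack n μ W (suc n) (replicate 6 0) []
  push : ∀ {d x sp a sp′ a′ fs} → suc x < d → x < 2 ^ W → Push μ W d x sp a sp′ a′ →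
    Stack n μ W sp a fs → Stack n μ W sp′ a′ ((d , x) ∷ fs)

digit-< : ∀ {A x q} C → A < q ^ C → x < q → A * q + x < q ^ suc C
digit-< {A} {x} {q} C A< x<q = begin-strict
  A * q + x    <⟨ +-monoʳ-< (A * q) x<q ⟩
  A * q + q    ≡⟨ +-comm (A * q) q ⟩
  suc A * q    ≤⟨ *-monoˡ-≤ q A< ⟩
  q ^ C * q    ≡⟨ *-comm (q ^ C) q ⟩
  q ^ suc C    ∎
  where open ≤-Reasoning

AccOK : (q A C : ℕ) → Set
AccOK q A C = A < q ^ C × C ≤ 4

AccsOK : Vec ℕ 6 → Set
AccsOK (a₄ ∷ c₄ ∷ a₆ ∷ c₆ ∷ a₇ ∷ c₇ ∷ []) = AccOK 3 a₄ c₄ × AccOK 5 a₆ c₆ × AccOK 6 a₇ c₇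

accPush-ok : ∀ {μ q x sp A C sp′ A′ C′} → x < q → AccPush μ q x sp A C sp′ A′ C′ →
  AccOK q A C → AccOK q A′ C′
accPush-ok x<q (part {C = C} C<4) (A< , _) = digit-< C A< x<q , C<4
accPush-ok x<q (full _)           _        = s≤s z≤n , z≤n

stack-accs : ∀ {n μ W sp a fs} → Stack n μ W sp a fs → AccsOK a
stack-accs [] = (s≤s z≤n , z≤n) , (s≤s z≤n , z≤n) , (s≤s z≤n , z≤n)
stack-accs (push x< _ (at4 p) st) with stack-accs st
... | o₄ , o₆ , o₇ = accPush-ok (s≤s⁻¹ x<) p o₄ , o₆ , o₇
stack-accs (push x< _ (at6 p) st) with stack-accs st
... | o₄ , o₆ , o₇ = o₄ , accPush-ok (s≤s⁻¹ x<) p o₆ , o₇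
stack-accs (push x< _ (at7 p) st) with stack-accs st
... | o₄ , o₆ , o₇ = o₄ , o₆ , accPush-ok (s≤s⁻¹ x<) p o₇
stack-accs (push _ _ (direct _ _) st) = stack-accs st

-- The value of the waiting digits in fifths of a bit, 2d for each digit.
buffered : Vec ℕ 6 → ℕ
buffered (_ ∷ c₄ ∷ _ ∷ c₆ ∷ _ ∷ c₇ ∷ []) = 8 * c₄ + 12 * c₆ + 14 * c₇

-- An exact balance: the 2d bits of a full block cost 10d fifths, which is what its five digits
-- contribute.
accPush-space : ∀ {μ q x sp A C sp′ A′ C′} → AccPush μ q x sp A C sp′ A′ C′ →
  5 * sp′ + 2 * suc q * C′ ≡ 5 * sp + 2 * suc q * C + 2 * suc q
accPush-space {q = q} (part {sp} {C = C} _) = lemma sp q C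
  where
  lemma : ∀ sp q C → 5 * sp + 2 * suc q * suc C ≡ 5 * sp + 2 * suc q * C + 2 * suc q
  lemma = solve-∀
accPush-space {q = q} (full {sp} _) = lemma sp q
  where
  lemma : ∀ sp q → 5 * (sp + (suc q + suc q)) + 2 * suc q * 0 ≡ 5 * sp + 2 * suc q * 4 + 2 * suc q
  lemma = solve-∀

push-space : ∀ {μ W d x sp a sp′ a′} → Push μ W d x sp a sp′ a′ →
  5 * sp′ + buffered a′ ≤ 5 * sp + buffered a + 2 * d
push-space (at4 {sp = sp} {C = C} {sp′} {C′ = C′} {c₆ = c₆} {c₇ = c₇} p) = ≤-reflexive
  (trans (out sp′ C′ c₆ c₇) (trans (cong (_+ (12 * c₆ + 14 * c₇)) (accPush-space p)) (back sp C c₆ c₇)))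
  where
  out : ∀ s a b c → 5 * s + (8 * a + 12 * b + 14 * c) ≡ 5 * s + 8 * a + (12 * b + 14 * c)
  out = solve-∀
  back : ∀ s a b c → 5 * s + 8 * a + 8 + (12 * b + 14 * c) ≡ 5 * s + (8 * a + 12 * b + 14 * c) + 8
  back = solve-∀
push-space (at6 {sp = sp} {C = C} {sp′} {C′ = C′} {c₄ = c₄} {c₇ = c₇} p) = ≤-reflexive
  (trans (out sp′ c₄ C′ c₇) (trans (cong (_+ (8 * c₄ + 14 * c₇)) (accPush-space p)) (back sp c₄ C c₇)))
  where
  out : ∀ s a b c → 5 * s + (8 * a + 12 * b + 14 * c) ≡ 5 * s + 12 * b + (8 * a + 14 * c)
  out = solve-∀
  back : ∀ s a b c → 5 * s + 12 * b + 12 + (8 * a + 14 * c) ≡ 5 * s + (8 * a + 12 * b + 14 * c) + 12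
  back = solve-∀
push-space (at7 {sp = sp} {C = C} {sp′} {C′ = C′} {c₄ = c₄} {c₆ = c₆} p) = ≤-reflexive
  (trans (out sp′ c₄ c₆ C′) (trans (cong (_+ (8 * c₄ + 12 * c₆)) (accPush-space p)) (back sp c₄ c₆ C)))
  where
  out : ∀ s a b c → 5 * s + (8 * a + 12 * b + 14 * c) ≡ 5 * s + 14 * c + (8 * a + 12 * b)
  out = solve-∀
  back : ∀ s a b c → 5 * s + 14 * c + 14 + (8 * a + 12 * b) ≡ 5 * s + (8 * a + 12 * b + 14 * c) + 14
  back = solve-∀
push-space {W = W} (direct {d} {sp = sp} {a} _ _) = begin
  5 * (sp + width W d) + buffered a          ≡⟨ shuffle sp (width W d) (buffered a) ⟩
  5 * sp + buffered a + 5 * width W d        ≤⟨ +-monoʳ-≤ (5 * sp + buffered a) (5*width≤ W d) ⟩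
  5 * sp + buffered a + (d + d)              ≡⟨ cong (λ e → 5 * sp + buffered a + (d + e)) (+-identityʳ d) ⟨
  5 * sp + buffered a + 2 * d                ∎
  where
  open ≤-Reasoning
  shuffle : ∀ s l b → 5 * (s + l) + b ≡ 5 * s + b + 5 * l
  shuffle = solve-∀

-- In fifths of a bit: n + 1 bits in front of the stack, and 2d/5 bits for each frame.
demand : ℕ → List (ℕ × ℕ) → ℕ
demand n fs = 5 * suc n + 2 * sum (map proj₁ fs)

demand-∷ : ∀ n d x fs → demand n ((d , x) ∷ fs) ≡ demand n fs + 2 * d
demand-∷ n d x fs = lemma (5 * suc n) d (sum (map proj₁ fs))
  where
  lemma : ∀ a d s → a + 2 * (d + s) ≡ a + 2 * s + 2 * d
  lemma = solve-∀

stack-space : ∀ {n μ W sp a fs} → Stack n μ W sp a fs → 5 * sp + buffered a ≤ demand n fs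
stack-space {n} [] = ≤-refl
stack-space {n} {fs = (d , x) ∷ fs} (push {sp = sp} {a} {sp′} {a′} _ _ p st) = begin
  5 * sp′ + buffered a′         ≤⟨ push-space p ⟩
  5 * sp + buffered a + 2 * d   ≤⟨ +-monoˡ-≤ (2 * d) (stack-space st) ⟩
  demand n fs + 2 * d           ≡⟨ demand-∷ n d x fs ⟨
  demand n ((d , x) ∷ fs)       ∎
  where open ≤-Reasoning

-- `M` will contain ⌊4m/5⌋, and the slack 4 makes up for this rounding; it disappears again because
-- `s` is an integer.
room : ∀ {M s} → 5 * s ≤ 5 * M + 4 → s ≤ M
room {M} {s} 5s≤ = s≤s⁻¹ (*-cancelˡ-< 5 s (suc M) (begin-strict
  5 * s        ≤⟨ 5s≤ ⟩
  5 * M + 4    <⟨ n<1+n _ ⟩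
  suc (5 * M + 4) ≡⟨ lemma M ⟩
  5 * suc M    ∎))
  where
  open ≤-Reasoning
  lemma : ∀ M → suc (5 * M + 4) ≡ 5 * suc M
  lemma = solve-∀

stack-room : ∀ {n μ W sp a fs M} → Stack n μ W sp a fs → demand n fs ≤ 5 * M + 4 → sp ≤ M
stack-room {sp = sp} st enough =
  room (≤-trans (m≤m+n (5 * sp) _) (≤-trans (stack-space st) enough))

-- Room is needed before the write takes place. The new bits are paid for by the digits already
-- waiting together with the share 2d of the new frame.
push-room : ∀ {n μ W sp a fs M d x ℓ} → Stack n μ W sp a fs →
  demand n ((d , x) ∷ fs) ≤ 5 * M + 4 → 5 * ℓ ≤ buffered a + 2 * d → sp + ℓ ≤ M
push-room {n} {sp = sp} {a} {fs} {M} {d} {x} {ℓ} st enough ℓ≤ = room (begin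
  5 * (sp + ℓ)                    ≡⟨ *-distribˡ-+ 5 sp ℓ ⟩
  5 * sp + 5 * ℓ                  ≤⟨ +-monoʳ-≤ (5 * sp) ℓ≤ ⟩
  5 * sp + (buffered a + 2 * d)   ≡⟨ +-assoc (5 * sp) _ _ ⟨
  5 * sp + buffered a + 2 * d     ≤⟨ +-monoˡ-≤ (2 * d) (stack-space st) ⟩
  demand n fs + 2 * d             ≡⟨ demand-∷ n d x fs ⟨
  demand n ((d , x) ∷ fs)         ≤⟨ enough ⟩
  5 * M + 4                       ∎)
  where open ≤-Reasoning

accPush-sp : ∀ {μ q x sp A C sp′ A′ C′} → AccPush μ q x sp A C sp′ A′ C′ → sp ≤ sp′
accPush-sp (part _) = ≤-refl
accPush-sp (full _) = m≤m+n _ _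

push-sp : ∀ {μ W d x sp a sp′ a′} → Push μ W d x sp a sp′ a′ → sp ≤ sp′
push-sp (at4 p)      = accPush-sp p
push-sp (at6 p)      = accPush-sp p
push-sp (at7 p)      = accPush-sp p
push-sp (direct _ _) = m≤m+n _ _

stack-sp : ∀ {n μ W sp a fs} → Stack n μ W sp a fs → n < sp
stack-sp []             = ≤-refl
stack-sp (push _ _ p st) = ≤-trans (stack-sp st) (push-sp p)

accPush-cong : ∀ {μ μ′ q x sp A C sp′ A′ C′} → (∀ i → sp ≤ i → i < sp′ → μ′ i ≡ μ i) →
  AccPush μ q x sp A C sp′ A′ C′ → AccPush μ′ q x sp A C sp′ A′ C′
accPush-cong same (part C<4)       = part C<4
accPush-cong same (full {sp} read) = full (trans (readBits-cong sp _ same) read)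

push-cong : ∀ {μ μ′ W d x sp a sp′ a′} → (∀ i → sp ≤ i → i < sp′ → μ′ i ≡ μ i) →
  Push μ W d x sp a sp′ a′ → Push μ′ W d x sp a sp′ a′
push-cong same (at4 p) = at4 (accPush-cong same p)
push-cong same (at6 p) = at6 (accPush-cong same p)
push-cong same (at7 p) = at7 (accPush-cong same p)
push-cong same (direct {sp = sp} dir read) = direct dir (trans (readBits-cong sp _ same) read)

-- Covers both kinds of writes outside the stack: marks change bits up to `n`, and pushes change
-- bits from `sp` on.
stack-cong : ∀ {n μ μ′ W sp a fs} → (∀ i → n < i → i < sp → μ′ i ≡ μ i) →
  Stack n μ W sp a fs → Stack n μ′ W sp a fs
stack-cong same [] = []
stack-cong same (push x< x<2^W p st) = push x< x<2^W
  (push-cong (λ i sp≤i → same i (<-≤-trans (stack-sp st) sp≤i)) p)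
  (stack-cong (λ i n<i i<sp → same i n<i (<-≤-trans i<sp (push-sp p))) st)

-- Execution of the stack operations

file : (u p j r t v sp W d x y A C : ℕ) → Vec ℕ 6 → Memory → Config registerCount
file u p j r t v sp W d x y A C a μ =
  config (u ∷ p ∷ j ∷ r ∷ t ∷ v ∷ sp ∷ W ∷ d ∷ x ∷ y ∷ A ∷ C ∷ a) μ

-- Opaque, because the numerals would be unfolded to unary ones.
record Fits (q : ℕ) : Set where
  constructor mkFits
  field
    five-digits : suc q ^ 5 ≤ 2 ^ (suc (suc q) + suc (suc q))

abstract
  fits-3 : Fits 2
  fits-3 = mkFits (≤ᵇ⇒≤ _ _ tt)

  fits-5 : Fits 4
  fits-5 = mkFits (≤ᵇ⇒≤ _ _ tt)

  fits-6 : Fits 5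
  fits-6 = mkFits (≤ᵇ⇒≤ _ _ tt)

  6^4≤2^14 : 6 ^ 4 ≤ 2 ^ 14
  6^4≤2^14 = ≤ᵇ⇒≤ _ _ tt

module StackExecution {S : Signature} (I : Input S) (n w b M : ℕ) (b≤w : b ≤ w)
                      (14≤b : 14 ≤ b) (M<2^b : M < 2 ^ b) where
  abstract
    -- Between operations an accumulator has at most four digits, in radix at most 6. The
    -- requirement `14≤b` comes from the largest block, that of d = 7.
    6^4≤2^b : 6 ^ 4 ≤ 2 ^ b
    6^4≤2^b = ≤-trans 6^4≤2^14 (^-monoʳ-≤ 2 14≤b)

  32≤2^b : 32 ≤ 2 ^ b
  32≤2^b = ^-monoʳ-≤ 2 (≤-trans (≤ᵇ⇒≤ 5 14 tt) 14≤b)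

  open Execution I registerCount w b M b≤w 32≤2^b public
  open Stacks {S}

  AccPushed : (u p j r t v sp W q x y A C : ℕ) → Vec ℕ 6 → Memory → Set
  AccPushed u p j r t v sp W q x y A C a μ =
    ∃[ T ] ∃[ sp′ ] ∃[ y′ ] ∃[ A′ ] ∃[ C′ ] ∃[ μ′ ]
      T ≤ 12 × A′ < 2 ^ b × C′ < 2 ^ b ×
      Exec accPush (file u p j r t v sp W (suc (suc q)) x y A C a μ) T []
        (file u p j r t v sp′ W (suc (suc q)) x y′ A′ C′ a μ′) ×
      AccPush μ′ (suc q) x sp A C sp′ A′ C′ × (∀ i → i < sp → μ′ i ≡ μ i)

  AccPopped : (u p j r t v sp′ W q x₀ y A′ C′ : ℕ) → Vec ℕ 6 → Memory → (x sp A C : ℕ) → Set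
  AccPopped u p j r t v sp′ W q x₀ y A′ C′ a μ x sp A C =
    ∃[ T ] ∃[ y′ ]
      T ≤ 12 × A < 2 ^ b × C < 2 ^ b ×
      Exec accPop (file u p j r t v sp′ W (suc (suc q)) x₀ y A′ C′ a μ) T []
        (file u p j r t v sp W (suc (suc q)) x y′ A C a μ)

  abstract
    accPush-exec : ∀ {u p j r t v sp W x y A C a μ} q →
      Fits q → suc (suc q) + suc (suc q) ≤ 14 →
      x < suc q → AccOK (suc q) A C →
      sp < 2 ^ b → (C ≡ 4 → sp + (suc (suc q) + suc (suc q)) ≤ M) →
      AccPushed u p j r t v sp W q x y A C a μ
    accPush-exec {u} {p} {j} {r} {t} {v} {sp} {W} {x} {y} {A} {C} {a} {μ}
                 q (mkFits five-digits) 2d≤14 x<q (A< , C≤4) sp< enough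
      = helper (C ≟ 4)
      where
      2d : ℕ
      2d = suc (suc q) + suc (suc q)
      A₁<2^2d : A * suc q + x < 2 ^ 2d
      A₁<2^2d = <-≤-trans (digit-< C A< x<q) (≤-trans (^-monoʳ-≤ (suc q) (s≤s C≤4)) five-digits)
      A₁<2^b : A * suc q + x < 2 ^ b
      A₁<2^b = <-≤-trans A₁<2^2d (^-monoʳ-≤ 2 (≤-trans 2d≤14 14≤b))
      2d<2^b : 2d < 2 ^ b
      2d<2^b = <-≤-trans (s≤s 2d≤14) (≤-trans (≤ᵇ⇒≤ 15 32 tt) 32≤2^b)
      d<2^b : suc (suc q) < 2 ^ b
      d<2^b = ≤-<-trans (m≤m+n _ _) 2d<2^b
      C+1<2^b : suc C < 2 ^ b
      C+1<2^b = ≤-<-trans (s≤s C≤4) (small 5)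
      helper : Dec (C ≡ 4) → AccPushed u p j r t v sp W q x y A C a μ
      helper (yes refl) = _ , _ , _ , _ , _ , _ , ≤ᵇ⇒≤ _ 12 tt , small 0 , small 0 ,
        (set-sub refl (constant 1) refl d<2^b ⨾
         set-mul refl refl refl (≤-<-trans (m≤m+n _ x) A₁<2^b) ⨾
         set-add refl refl refl A₁<2^b ⨾
         set-add refl (constant 1) refl C+1<2^b ⨾
         set-eq-yes refl (constant 5) refl ⨾
         cond-true (λ ())
           (set-add refl refl refl 2d<2^b ⨾
            put refl refl refl (≤-trans 2d≤14 (≤-trans 14≤b b≤w) , enough refl) ⨾
            set-add refl refl refl (≤-<-trans (enough refl) M<2^b) ⨾
            set (constant 0) (small 0) ⨾
            set (constant 0) (small 0))) ,
        full (readBits-writeBits μ sp 2d _ A₁<2^2d) , writeBits-below μ sp 2d _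
      helper (no C≢4) = _ , _ , _ , _ , _ , _ , ≤ᵇ⇒≤ _ 12 tt , A₁<2^b , C+1<2^b ,
        (set-sub refl (constant 1) refl d<2^b ⨾
         set-mul refl refl refl (≤-<-trans (m≤m+n _ x) A₁<2^b) ⨾
         set-add refl refl refl A₁<2^b ⨾
         set-add refl (constant 1) (+-comm C 1) C+1<2^b ⨾
         set-eq-no refl (constant 5) (C≢4 ∘ suc-injective) ⨾
         cond-false refl skip) ,
        part (≤∧≢⇒< C≤4 C≢4) , λ _ _ → refl

    -- After `part` the count is a successor, so nothing is loaded; after `full` it is 0 and the
    -- block is read back. In either case A·q + x is now in the accumulator, and division by q = d -
    -- 1 separates the last digit.
    accPop-exec : ∀ {u p j r t v sp W x₀ y A′ C′ a μ sp′ x A C} q →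
      Fits q → suc (suc q) + suc (suc q) ≤ 14 →
      x < suc q → AccOK (suc q) A C → sp′ ≤ M →
      AccPush μ (suc q) x sp A C sp′ A′ C′ →
      AccPopped u p j r t v sp′ W q x₀ y A′ C′ a μ x sp A C
    accPop-exec {sp = sp} {x = x} {A} {C} q (mkFits five-digits) 2d≤14 x<q (A< , C≤4) sp′≤M₀ = helper sp′≤M₀
      where
      2d : ℕ
      2d = suc (suc q) + suc (suc q)
      A₁<2^b : A * suc q + x < 2 ^ b
      A₁<2^b = <-≤-trans (digit-< C A< x<q) (≤-trans (^-monoʳ-≤ (suc q) (s≤s C≤4))
        (≤-trans five-digits (^-monoʳ-≤ 2 (≤-trans 2d≤14 14≤b))))
      A<2^b : A < 2 ^ b
      A<2^b = ≤-<-trans (≤-trans (m≤m*n A (suc q)) (m≤m+n _ x)) A₁<2^b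
      2d<2^b : 2d < 2 ^ b
      2d<2^b = <-≤-trans (s≤s 2d≤14) (≤-trans (≤ᵇ⇒≤ 15 32 tt) 32≤2^b)
      d<2^b : suc (suc q) < 2 ^ b
      d<2^b = ≤-<-trans (m≤m+n _ _) 2d<2^b
      C<2^b : C < 2 ^ b
      C<2^b = ≤-<-trans C≤4 (small 4)
      low : (A * suc q + x) % suc q ≡ x
      low = trans (cong (_% suc q) (+-comm (A * suc q) x))
        (trans ([m+kn]%n≡m%n x A (suc q)) (m<n⇒m%n≡m x<q))
      high : (A * suc q + x) / suc q ≡ A
      high = begin
        (A * suc q + x) / suc q          ≡⟨ +-distrib-/-∣ˡ x {suc q} (divides-refl A) ⟩
        A * suc q / suc q + x / suc q    ≡⟨ cong₂ _+_ (m*n/n≡m A (suc q)) (m<n⇒m/n≡0 x<q) ⟩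
        A + 0                            ≡⟨ +-identityʳ A ⟩
        A                                ∎
        where open ≡-Reasoning
      x<2^b : x < 2 ^ b
      x<2^b = ≤-<-trans (m≤n+m x _) A₁<2^b
      helper : ∀ {u p j r t v W x₀ y A′ C′ a μ sp′} → sp′ ≤ M → AccPush μ (suc q) x sp A C sp′ A′ C′ →
        AccPopped u p j r t v sp′ W q x₀ y A′ C′ a μ x sp A C
      helper sp′≤M (part C<4) = _ , _ , ≤ᵇ⇒≤ _ 12 tt , A<2^b , C<2^b ,
        (cond-true (λ ()) skip ⨾
         set-sub refl (constant 1) refl d<2^b ⨾
         set-mod refl refl low x<2^b ⨾
         set-div refl refl high A<2^b ⨾
         set-sub refl (constant 1) refl (≤-<-trans (s≤s C≤4) (small 5)))
      helper sp′≤M (full read) = _ , _ , ≤ᵇ⇒≤ _ 12 tt , A<2^b , C<2^b ,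
        (cond-false refl
           (set-add refl refl refl 2d<2^b ⨾
            set-sub refl refl (+-comm 2d sp) (≤-<-trans sp′≤M M<2^b) ⨾
            set-load refl refl (≤-trans 2d≤14 (≤-trans 14≤b b≤w) , sp′≤M) read A₁<2^b ⨾
            set (constant 5) (small 5)) ⨾
         set-sub refl (constant 1) refl d<2^b ⨾
         set-mod refl refl low x<2^b ⨾
         set-div refl refl high A<2^b ⨾
         set-sub refl (constant 1) refl (small 5))

classify : ∀ d → Packed d ⊎ Direct d
classify d with d ≟ 4 | d ≟ 6 | d ≟ 7
... | yes eq | _      | _      = inj₁ (inj₁ eq)
... | no _   | yes eq | _      = inj₁ (inj₂ (inj₁ eq))
... | no _   | no _   | yes eq = inj₁ (inj₂ (inj₂ eq))
... | no ≢4  | no ≢6  | no ≢7  = inj₂ λ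
  { (inj₁ eq) → ≢4 eq ; (inj₂ (inj₁ eq)) → ≢6 eq ; (inj₂ (inj₂ eq)) → ≢7 eq }

-- Adds up the time of a run that consists of `a` units, a part known only to take at most `B`
-- units, and `c` units. The numerals are compared by evaluation.
within : ∀ a c {B T} bound {_ : True (a + (B + c) ≤? bound)} → T ≤ B → a + (T + c) ≤ bound
within a c bound {evidence} T≤B = ≤-trans (+-monoʳ-≤ a (+-monoˡ-≤ c T≤B)) (toWitness evidence)

module PackedExecution {S : Signature} (I : Input S) (n w b M : ℕ) (b≤w : b ≤ w)
                       (14≤b : 14 ≤ b) (M<2^b : M < 2 ^ b) where
  open StackExecution I n w b M b≤w 14≤b M<2^b public
  open Stacks {S}

  width≤W : ∀ W d → width W d ≤ W
  width≤W W d = m⊓n≤n ((d + d) / 5) W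

  directWidth-exec : ∀ {u p j r t v sp W d x y A C a μ} → d + d < 2 ^ b → W < 2 ^ b →
    ∃[ T ] ∃[ t′ ] T ≤ 5 ×
      Exec directWidth (file u p j r t v sp W d x y A C a μ) T []
        (file u p j r t′ v sp W d x (width W d) A C a μ)
  directWidth-exec {u} {p} {j} {r} {t} {v} {sp} {W} {d} {x} {y} {A} {C} {a} {μ} 2d< W<
    with <-≤-connex W ((d + d) / 5)
  ... | inj₁ W<y rewrite m≥n⇒m⊓n≡n (<⇒≤ W<y) = _ , _ , ≤-refl ,
    (set-add refl refl refl 2d< ⨾
     set-div refl (constant 5) refl (≤-<-trans (m/n≤m (d + d) 5) 2d<) ⨾
     set-lt-yes refl refl W<y ⨾
     cond-true (λ ()) (set refl W<))
  ... | inj₂ y≤W rewrite m≤n⇒m⊓n≡m y≤W = _ , _ , ≤-refl ,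
    (set-add refl refl refl 2d< ⨾
     set-div refl (constant 5) refl (≤-<-trans (m/n≤m (d + d) 5) 2d<) ⨾
     set-lt-no refl refl y≤W ⨾
     cond-false refl skip)

  acc-small : ∀ {q A C} → suc q ≤ 6 → AccOK (suc q) A C → A < 2 ^ b × C < 2 ^ b
  acc-small {q} {A} {C} q≤6 (A< , C≤4) =
    <-≤-trans A< (begin
      suc q ^ C   ≤⟨ ^-monoʳ-≤ (suc q) C≤4 ⟩
      suc q ^ 4   ≤⟨ ^-monoˡ-≤ 4 q≤6 ⟩
      6 ^ 4       ≤⟨ 6^4≤2^b ⟩
      2 ^ b       ∎) ,
    ≤-<-trans C≤4 (small 4)
    where open ≤-Reasoning

  PushResult : (u p j r t v sp W d x y A C : ℕ) → Vec ℕ 6 → Memory → List (ℕ × ℕ) → Set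
  PushResult u p j r t v sp W d x y A C a μ fs =
    ∃[ T ] ∃[ t′ ] ∃[ sp′ ] ∃[ y′ ] ∃[ A′ ] ∃[ C′ ] ∃[ a′ ] ∃[ μ′ ]
      T ≤ 25 ×
      Exec packedPush (file u p j r t v sp W d x y A C a μ) T []
        (file u p j r t′ v sp′ W d x y′ A′ C′ a′ μ′) ×
      Stack n μ′ W sp′ a′ ((d , x) ∷ fs) × (∀ i → i ≤ n → μ′ i ≡ μ i)

  packedPush-exec : ∀ {u p j r t v sp W d x y A C a μ fs} →
    Stack n μ W sp a fs → suc x < d → x < 2 ^ W → d + d < 2 ^ b → W ≤ b →
    demand n ((d , x) ∷ fs) ≤ 5 * M + 4 →
    PushResult u p j r t v sp W d x y A C a μ fs
  packedPush-exec {u} {p} {j} {r} {t} {v} {sp} {W} {d} {x} {y} {A} {C}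
                  {a@(a₄ ∷ c₄ ∷ a₆ ∷ c₆ ∷ a₇ ∷ c₇ ∷ [])} {μ} {fs} st x<d x<2^W 2d< W≤b enough
    = helper (classify d)
    where
    sp≤M : sp ≤ M
    sp≤M = stack-room st (≤-trans (≤-trans (m≤m+n _ (2 * d)) (≤-reflexive (sym (demand-∷ n d x fs)))) enough)
    sp<2^b : sp < 2 ^ b
    sp<2^b = ≤-<-trans sp≤M M<2^b
    rebuild : ∀ {sp′ a′ μ′} → (∀ i → i < sp → μ′ i ≡ μ i) → Push μ′ W d x sp a sp′ a′ →
      Stack n μ′ W sp′ a′ ((d , x) ∷ fs) × (∀ i → i ≤ n → μ′ i ≡ μ i)
    rebuild same p = push x<d x<2^W p (stack-cong (λ i _ → same i) st) ,
      λ i i≤n → same i (≤-<-trans i≤n (stack-sp st))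
    helper : Packed d ⊎ Direct d → PushResult u p j r t v sp W d x y A C a μ fs
    helper (inj₁ (inj₁ refl)) = finish′ (accPush-exec 2 fits-3 (≤ᵇ⇒≤ _ _ tt) (s≤s⁻¹ x<d) ok sp<2^b
             -- The block of 8 bits costs 40 fifths: 32 come from the four waiting digits and 8 from
             -- the new one. The cases d = 6 and d = 7 are analogous with 48 + 12 and 56 + 14.
             (λ { refl → push-room {d = 4} {x} st enough
                  (+-monoˡ-≤ 8 (≤-trans (m≤m+n 32 (12 * c₆)) (m≤m+n _ (14 * c₇)))) }))
      where
      ok : AccOK 3 a₄ c₄
      ok = proj₁ (stack-accs st)
      finish′ : AccPushed u p j r 1 v sp W 2 x y a₄ c₄ a μ → PushResult u p j r t v sp W 4 x y A C a μ fs
      finish′ (_ , _ , _ , _ , _ , _ , T≤ , A′< , C′< , exec , pushed , same) =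
        _ , _ , _ , _ , _ , _ , _ , _ , within 4 2 25 T≤ ,
        (set-eq-yes refl (constant 4) refl ⨾
         cond-true (λ ())
           (set refl (proj₁ (acc-small (≤ᵇ⇒≤ _ _ tt) ok)) ⨾
            set refl (proj₂ (acc-small (≤ᵇ⇒≤ _ _ tt) ok)) ⨾
            exec ⨾ set refl A′< ⨾ set refl C′<)) ,
        rebuild same (at4 pushed)
    helper (inj₁ (inj₂ (inj₁ refl))) = finish′ (accPush-exec 4 fits-5 (≤ᵇ⇒≤ _ _ tt) (s≤s⁻¹ x<d) ok sp<2^b
             (λ { refl → push-room {d = 6} {x} st enough
                  (+-monoˡ-≤ 12 (≤-trans (m≤n+m 48 (8 * c₄)) (m≤m+n _ (14 * c₇)))) }))
      where
      ok : AccOK 5 a₆ c₆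
      ok = proj₁ (proj₂ (stack-accs st))
      finish′ : AccPushed u p j r 1 v sp W 4 x y a₆ c₆ a μ → PushResult u p j r t v sp W 6 x y A C a μ fs
      finish′ (_ , _ , _ , _ , _ , _ , T≤ , A′< , C′< , exec , pushed , same) =
        _ , _ , _ , _ , _ , _ , _ , _ , within 6 2 25 T≤ ,
        (set-eq-no refl (constant 4) (λ ()) ⨾
         cond-false refl
        (set-eq-yes refl (constant 6) refl ⨾
         cond-true (λ ())
           (set refl (proj₁ (acc-small (≤ᵇ⇒≤ _ _ tt) ok)) ⨾
            set refl (proj₂ (acc-small (≤ᵇ⇒≤ _ _ tt) ok)) ⨾
            exec ⨾ set refl A′< ⨾ set refl C′<))) ,
        rebuild same (at6 pushed)
    helper (inj₁ (inj₂ (inj₂ refl))) = finish′ (accPush-exec 5 fits-6 (≤ᵇ⇒≤ _ _ tt) (s≤s⁻¹ x<d) ok sp<2^b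
             (λ { refl → push-room {d = 7} {x} st enough
                  (+-monoˡ-≤ 14 (m≤n+m 56 (8 * c₄ + 12 * c₆))) }))
      where
      ok : AccOK 6 a₇ c₇
      ok = proj₂ (proj₂ (stack-accs st))
      finish′ : AccPushed u p j r 1 v sp W 5 x y a₇ c₇ a μ → PushResult u p j r t v sp W 7 x y A C a μ fs
      finish′ (_ , _ , _ , _ , _ , _ , T≤ , A′< , C′< , exec , pushed , same) =
        _ , _ , _ , _ , _ , _ , _ , _ , within 8 2 25 T≤ ,
        (set-eq-no refl (constant 4) (λ ()) ⨾
         cond-false refl
        (set-eq-no refl (constant 6) (λ ()) ⨾
         cond-false refl
        (set-eq-yes refl (constant 7) refl ⨾
         cond-true (λ ())
           (set refl (proj₁ (acc-small (≤ᵇ⇒≤ _ _ tt) ok)) ⨾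
            set refl (proj₂ (acc-small (≤ᵇ⇒≤ _ _ tt) ok)) ⨾
            exec ⨾ set refl A′< ⨾ set refl C′<)))) ,
        rebuild same (at7 pushed)
    helper (inj₂ dir)
      with directWidth-exec {u} {p} {j} {r} {0} {v} {sp} {W} {d} {x} {y} {A} {C} {a} {μ}
             2d< (<-≤-trans (n<2^n W) (^-monoʳ-≤ 2 W≤b))
    ... | _ , _ , T≤ , exec =
      _ , _ , _ , _ , _ , _ , _ , _ , within 6 2 25 T≤ ,
      (set-eq-no refl (constant 4) (dir ∘ inj₁) ⨾
       cond-false refl
      (set-eq-no refl (constant 6) (dir ∘ inj₂ ∘ inj₁) ⨾
       cond-false refl
      (set-eq-no refl (constant 7) (dir ∘ inj₂ ∘ inj₂) ⨾
       cond-false refl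
      (exec ⨾
       put refl refl refl (≤-trans (width≤W W d) (≤-trans W≤b b≤w) , inside) ⨾
       set-add refl refl refl (≤-<-trans inside M<2^b))))) ,
      rebuild (writeBits-below μ sp (width W d) x)
        (direct dir (readBits-writeBits μ sp (width W d) x (<2^width dir x<d x<2^W)))
      where
      inside : sp + width W d ≤ M
      inside = push-room {d = d} {x} st enough (≤-trans (5*width≤ W d)
        (≤-trans (≤-reflexive (cong (d +_) (sym (+-identityʳ d)))) (m≤n+m (2 * d) (buffered a))))

  PopResult : (u p j r t v sp′ W d x₀ y A C : ℕ) → Vec ℕ 6 → Memory → ℕ → List (ℕ × ℕ) → Set
  PopResult u p j r t v sp′ W d x₀ y A C a′ μ x fs =
    ∃[ T ] ∃[ t′ ] ∃[ sp ] ∃[ y′ ] ∃[ A′ ] ∃[ C′ ] ∃[ a ]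
      T ≤ 25 ×
      Exec packedPop (file u p j r t v sp′ W d x₀ y A C a′ μ) T []
        (file u p j r t′ v sp W d x y′ A′ C′ a μ) ×
      Stack n μ W sp a fs

  -- Push and pop select their branch by `d` alone, so the pop meets the accumulator or the field
  -- that the last push used. The bounds on the accumulators before and after that push show that
  -- copying them to and fro stays within `b` bits.
  packedPop-exec : ∀ {u p j r t v sp′ W d x₀ y A C a′ μ x fs} →
    Stack n μ W sp′ a′ ((d , x) ∷ fs) → d + d < 2 ^ b → W ≤ b →
    demand n ((d , x) ∷ fs) ≤ 5 * M + 4 →
    PopResult u p j r t v sp′ W d x₀ y A C a′ μ x fs
  packedPop-exec {u} {p₀} {j} {r} {t} {v} {sp′} {W} {d} {x₀} {y} {A} {C} {a′} {μ} {x} {fs}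
                 st@(push x<d x<2^W pushed st₀) 2d< W≤b enough
    = helper pushed (stack-accs st) (stack-accs st₀) st₀
    where
    sp≤M : sp′ ≤ M
    sp≤M = stack-room st enough
    helper : ∀ {sp a} → Push μ W d x sp a sp′ a′ → AccsOK a′ → AccsOK a → Stack n μ W sp a fs →
      PopResult u p₀ j r t v sp′ W d x₀ y A C a′ μ x fs
    helper {sp} (at4 {A = A₀} {C₀} {A′ = A₁} {C₁} p) (ok′ , _ , _) (ok , _ , _) st₀ =
      finish′ (accPop-exec 2 fits-3 (≤ᵇ⇒≤ _ _ tt) (s≤s⁻¹ x<d) ok sp≤M p)
      where
      finish′ : AccPopped u p₀ j r 1 v sp′ W 2 x₀ y A₁ C₁ a′ μ x sp A₀ C₀ →
        PopResult u p₀ j r t v sp′ W 4 x₀ y A C a′ μ x fs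
      finish′ (_ , _ , T≤ , A< , C< , exec) =
        _ , _ , _ , _ , _ , _ , _ , within 4 2 25 T≤ ,
        (set-eq-yes refl (constant 4) refl ⨾
         cond-true (λ ())
           (set refl (proj₁ (acc-small (≤ᵇ⇒≤ _ _ tt) ok′)) ⨾
            set refl (proj₂ (acc-small (≤ᵇ⇒≤ _ _ tt) ok′)) ⨾
            exec ⨾ set refl A< ⨾ set refl C<)) , st₀
    helper {sp} (at6 {A = A₀} {C₀} {A′ = A₁} {C₁} p) (_ , ok′ , _) (_ , ok , _) st₀ =
      finish′ (accPop-exec 4 fits-5 (≤ᵇ⇒≤ _ _ tt) (s≤s⁻¹ x<d) ok sp≤M p)
      where
      finish′ : AccPopped u p₀ j r 1 v sp′ W 4 x₀ y A₁ C₁ a′ μ x sp A₀ C₀ →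
        PopResult u p₀ j r t v sp′ W 6 x₀ y A C a′ μ x fs
      finish′ (_ , _ , T≤ , A< , C< , exec) =
        _ , _ , _ , _ , _ , _ , _ , within 6 2 25 T≤ ,
        (set-eq-no refl (constant 4) (λ ()) ⨾
         cond-false refl
        (set-eq-yes refl (constant 6) refl ⨾
         cond-true (λ ())
           (set refl (proj₁ (acc-small (≤ᵇ⇒≤ _ _ tt) ok′)) ⨾
            set refl (proj₂ (acc-small (≤ᵇ⇒≤ _ _ tt) ok′)) ⨾
            exec ⨾ set refl A< ⨾ set refl C<))) , st₀
    helper {sp} (at7 {A = A₀} {C₀} {A′ = A₁} {C₁} p) (_ , _ , ok′) (_ , _ , ok) st₀ =
      finish′ (accPop-exec 5 fits-6 (≤ᵇ⇒≤ _ _ tt) (s≤s⁻¹ x<d) ok sp≤M p)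
      where
      finish′ : AccPopped u p₀ j r 1 v sp′ W 5 x₀ y A₁ C₁ a′ μ x sp A₀ C₀ →
        PopResult u p₀ j r t v sp′ W 7 x₀ y A C a′ μ x fs
      finish′ (_ , _ , T≤ , A< , C< , exec) =
        _ , _ , _ , _ , _ , _ , _ , within 8 2 25 T≤ ,
        (set-eq-no refl (constant 4) (λ ()) ⨾
         cond-false refl
        (set-eq-no refl (constant 6) (λ ()) ⨾
         cond-false refl
        (set-eq-yes refl (constant 7) refl ⨾
         cond-true (λ ())
           (set refl (proj₁ (acc-small (≤ᵇ⇒≤ _ _ tt) ok′)) ⨾
            set refl (proj₂ (acc-small (≤ᵇ⇒≤ _ _ tt) ok′)) ⨾
            exec ⨾ set refl A< ⨾ set refl C<)))) , st₀
    helper (direct {sp = sp} dir read) _ _ st₀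
      with directWidth-exec {u} {p₀} {j} {r} {0} {v} {sp′} {W} {d} {x₀} {y} {A} {C} {a′} {μ}
             2d< (<-≤-trans (n<2^n W) (^-monoʳ-≤ 2 W≤b))
    ... | _ , _ , T≤ , exec =
      _ , _ , _ , _ , _ , _ , _ , within 6 2 25 T≤ ,
      (set-eq-no refl (constant 4) (dir ∘ inj₁) ⨾
       cond-false refl
      (set-eq-no refl (constant 6) (dir ∘ inj₂ ∘ inj₁) ⨾
       cond-false refl
      (set-eq-no refl (constant 7) (dir ∘ inj₂ ∘ inj₂) ⨾
       cond-false refl
      (exec ⨾
       set-sub refl refl (+-comm (width W d) sp) (≤-<-trans sp≤M M<2^b) ⨾
       set-load refl refl (≤-trans (width≤W W d) (≤-trans W≤b b≤w) , sp≤M) read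
         (<-≤-trans x<2^W (^-monoʳ-≤ 2 W≤b)))))) , st₀

-- Frames of the search and their storage

main : (u p j r t v : ℕ) → Vec ℕ 13 → Memory → Config registerCount
main u p j r t v σ μ = config (u ∷ p ∷ j ∷ r ∷ t ∷ v ∷ σ) μ

-- The parts of an interface that depend on the graph: keyOf and payload are the
-- functions computed by key and encode.
record Correct {S : Signature} (F : Interface S) {n : ℕ} (D : DirectedGraph n) (I : Input S)
               (w b M : ℕ) : Set where
  private
    module F = Interface F
    module D = DirectedGraph D
  open Machine I {registerCount} w b M
  field
    size≡    : Input.size I ≡ n
    outdeg≡  : ∀ u → Input.access₁ I F.outdeg (label u) ≡ just (D.outdeg u)
    outhead≡ : ∀ u i → Input.access₂ I F.outhead (label u) (toℕ i) ≡ just (label (D.outhead u i))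
    inhead≡  : ∀ v i → Input.access₂ I F.inhead (label v) (toℕ i) ≡ just (label (D.inhead v i))
    outmate≡ : ∀ u i → Input.access₂ I F.outmate (label u) (toℕ i) ≡ just (toℕ (D.outmate u i))
    inmate≡  : ∀ v i → Input.access₂ I F.inmate (label v) (toℕ i) ≡ just (toℕ (D.inmate v i))
    keyOf    : Fin n → ℕ
    payload  : ℕ → ℕ → ℕ
    key<     : ∀ u → keyOf u + keyOf u < 2 ^ b
    payload≤ : ∀ p j → payload p j ≤ p
    payload< : ∀ u p i → D.inhead u p ≢ D.outhead u i →
      suc (payload (toℕ p) (toℕ i)) < keyOf u
    enough   : 5 * suc n + 2 * Σ[ keyOf ] ≤ 5 * M + 4
    key-exec : ∀ u {p j r t v sp W d x y A C a μ} → ∃[ T ] T ≤ 5 ×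
      Exec F.key (file (label u) p j r t v sp W d x y A C a μ) T []
        (file (label u) p j r t v sp W (keyOf u) x y A C a μ)
    encode-exec : ∀ {u p j r t v sp W d x y A C a μ} → p < 2 ^ b → ∃[ T ] ∃[ y′ ] T ≤ 5 ×
      Exec F.encode (file u p j r t v sp W d x y A C a μ) T []
        (file u p j r t v sp W d (payload p j) y′ A C a μ)
    decode-exec : ∀ u p i {p₀ r t v sp W d y A C a μ} → D.inhead u p ≢ D.outhead u i →
      ∃[ T ] ∃[ x′ ] ∃[ y′ ] T ≤ 5 ×
      Exec F.decode
        (file (label u) p₀ (toℕ i) r t v sp W d (payload (toℕ p) (toℕ i)) y A C a μ) T []
        (file (label u) (toℕ p) (toℕ i) r t v sp W d x′ y′ A C a μ)

module FrameStack {S : Signature} (F : Interface S) {n : ℕ} (D : DirectedGraph n) (I : Input S)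
                  (w b M : ℕ) (b≤w : b ≤ w) (14≤b : 14 ≤ b) (M<2^b : M < 2 ^ b)
                  (correct : Correct F D I w b M) where
  open DirectedGraph D
  open Correct correct public
  open PackedExecution I n w b M b≤w 14≤b M<2^b public
  open Traversal F

  -- To the search, the registers from `sp` on are one opaque vector. The lower bound on `W` lets
  -- every stored position fit under the cap, and the upper bound lets every field fit into a
  -- register.
  data Rep (fs : List (ℕ × ℕ)) : Vec ℕ 13 → Memory → Set where
    rep : ∀ {sp W d x y A C a μ} → n < 2 ^ W → W ≤ b → Stack n μ W sp a fs →
      Rep fs (sp ∷ W ∷ d ∷ x ∷ y ∷ A ∷ C ∷ a) μ

  rep-cong : ∀ {fs σ μ μ′} → (∀ i → n < i → μ′ i ≡ μ i) → Rep fs σ μ → Rep fs σ μ′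
  rep-cong same (rep n< W≤ st) = rep n< W≤ (stack-cong (λ i n<i _ → same i n<i) st)

  n<M : suc n ≤ M
  n<M = room (≤-trans (m≤m+n (5 * suc n) _) enough)

  n<2^b : n < 2 ^ b
  n<2^b = <-trans n<M M<2^b

  toℕ-in< : ∀ {u} (p : Fin (indeg u)) → toℕ p < n
  toℕ-in< {u} p = <-≤-trans (Fin.toℕ<n p) (indeg≤n D u)

  toℕ-out< : ∀ {u} (i : Fin (outdeg u)) → toℕ i < n
  toℕ-out< {u} i = <-≤-trans (Fin.toℕ<n i) (outdeg≤n D u)

  frame : ∀ u → Fin (indeg u) → Fin (outdeg u) → ℕ × ℕ
  frame u p i = keyOf u , payload (toℕ p) (toℕ i)

  Pushed : ℕ → ℕ → ℕ → (r t v : ℕ) → Vec ℕ 13 → Memory → List (ℕ × ℕ) → Set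
  Pushed u p j r t v σ μ fs =
    ∃[ T ] ∃[ t′ ] ∃[ σ′ ] ∃[ μ′ ] T ≤ 40 ×
      Exec pushFrame (main u p j r t v σ μ) T [] (main u p j r t′ v σ′ μ′) ×
      Rep fs σ′ μ′ × (∀ i → i ≤ n → μ′ i ≡ μ i)

  Popped : ℕ → ℕ → ℕ → (r t v : ℕ) → Vec ℕ 13 → Memory → ℕ → List (ℕ × ℕ) → Set
  Popped u p₀ j r t v σ μ p fs =
    ∃[ T ] ∃[ t′ ] ∃[ σ′ ] T ≤ 40 ×
      Exec popFrame (main u p₀ j r t v σ μ) T [] (main u p j r t′ v σ′ μ) × Rep fs σ′ μ

  abstract
    push-exec : ∀ u p i {r t v σ μ fs} → inhead u p ≢ outhead u i → Rep fs σ μ →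
      demand n (frame u p i ∷ fs) ≤ 5 * M + 4 →
      Pushed (label u) (toℕ p) (toℕ i) r t v σ μ (frame u p i ∷ fs)
    push-exec u p i {r} {t} {v} {μ = μ} {fs} differ (rep {sp} {W} {d} {x} {y} {A} {C} {a} n< W≤ st) fits =
      after-key (key-exec u)
      where
      σ : Vec ℕ 13
      σ = sp ∷ W ∷ d ∷ x ∷ y ∷ A ∷ C ∷ a
      p< : toℕ p < n
      p< = toℕ-in< p
      x< : payload (toℕ p) (toℕ i) < 2 ^ W
      x< = ≤-<-trans (payload≤ (toℕ p) (toℕ i)) (<-trans p< n<)
      total : ∀ {a b c} → a ≤ 5 → b ≤ 5 → c ≤ 25 → a + (b + c) ≤ 40
      total a≤ b≤ c≤ = ≤-trans (+-mono-≤ a≤ (+-mono-≤ b≤ c≤)) (≤ᵇ⇒≤ 35 40 tt)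
      goal : Set
      goal = Pushed (label u) (toℕ p) (toℕ i) r t v σ μ (frame u p i ∷ fs)
      finally : ∀ {T₁ T₂ y₁} → T₁ ≤ 5 → T₂ ≤ 5 →
        Exec (Interface.key F) (file (label u) (toℕ p) (toℕ i) r t v sp W d x y A C a μ) T₁ []
          (file (label u) (toℕ p) (toℕ i) r t v sp W (keyOf u) x y A C a μ) →
        Exec (Interface.encode F) (file (label u) (toℕ p) (toℕ i) r t v sp W (keyOf u) x y A C a μ) T₂ []
          (file (label u) (toℕ p) (toℕ i) r t v sp W (keyOf u) (payload (toℕ p) (toℕ i)) y₁ A C a μ) →
        PushResult (label u) (toℕ p) (toℕ i) r t v sp W (keyOf u) (payload (toℕ p) (toℕ i)) y₁ A C a μ fs →
        goal
      finally T₁≤ T₂≤ exec₁ exec₂ (_ , _ , _ , _ , _ , _ , _ , _ , T≤ , exec₃ , st′ , same) =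
        _ , _ , _ , _ , total T₁≤ T₂≤ T≤ , (exec₁ ⨾ exec₂ ⨾ exec₃) , rep n< W≤ st′ , same
      after-key : ∃[ T ] T ≤ 5 ×
        Exec (Interface.key F) (file (label u) (toℕ p) (toℕ i) r t v sp W d x y A C a μ) T []
          (file (label u) (toℕ p) (toℕ i) r t v sp W (keyOf u) x y A C a μ) → goal
      after-key (_ , T₁≤ , exec₁)
        with encode-exec {label u} {toℕ p} {toℕ i} {r} {t} {v} {sp} {W} {keyOf u} {x} {y} {A} {C} {a} {μ}
               (<-trans p< n<2^b)
      ... | _ , y₁ , T₂≤ , exec₂ = finally T₁≤ T₂≤ exec₁ exec₂
        (packedPush-exec st (payload< u p i differ) x< (key< u) W≤ fits)

    pop-exec : ∀ u p i {p₀ r t v σ μ fs} → inhead u p ≢ outhead u i → Rep (frame u p i ∷ fs) σ μ →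
      demand n (frame u p i ∷ fs) ≤ 5 * M + 4 →
      Popped (label u) p₀ (toℕ i) r t v σ μ (toℕ p) fs
    pop-exec u p i {p₀} {r} {t} {v} {μ = μ} {fs} differ (rep {sp} {W} {d} {x} {y} {A} {C} {a} n< W≤ st) fits =
      after-key (key-exec u)
      where
      σ : Vec ℕ 13
      σ = sp ∷ W ∷ d ∷ x ∷ y ∷ A ∷ C ∷ a
      total : ∀ {a b c} → a ≤ 5 → b ≤ 25 → c ≤ 5 → a + (b + c) ≤ 40
      total a≤ b≤ c≤ = ≤-trans (+-mono-≤ a≤ (+-mono-≤ b≤ c≤)) (≤ᵇ⇒≤ 35 40 tt)
      goal : Set
      goal = Popped (label u) p₀ (toℕ i) r t v σ μ (toℕ p) fs
      finally : ∀ {T₁} → T₁ ≤ 5 →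
        Exec (Interface.key F) (file (label u) p₀ (toℕ i) r t v sp W d x y A C a μ) T₁ []
          (file (label u) p₀ (toℕ i) r t v sp W (keyOf u) x y A C a μ) →
        PopResult (label u) p₀ (toℕ i) r t v sp W (keyOf u) x y A C a μ (payload (toℕ p) (toℕ i)) fs →
        goal
      finally T₁≤ exec₁ (_ , _ , sp′ , y′ , A′ , C′ , a′ , T≤ , exec₂ , st′)
        with decode-exec u p i {p₀} {r} {_} {v} {sp′} {W} {keyOf u} {y′} {A′} {C′} {a′} {μ} differ
      ... | _ , _ , _ , T₃≤ , exec₃ =
        _ , _ , _ , total T₁≤ T≤ T₃≤ , (exec₁ ⨾ exec₂ ⨾ exec₃) , rep n< W≤ st′
      after-key : ∃[ T ] T ≤ 5 ×
        Exec (Interface.key F) (file (label u) p₀ (toℕ i) r t v sp W d x y A C a μ) T []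
          (file (label u) p₀ (toℕ i) r t v sp W (keyOf u) x y A C a μ) → goal
      after-key (_ , T₁≤ , exec₁) = finally T₁≤ exec₁ (packedPop-exec st (key< u) W≤ fits)

-- Invariants of the search

marked : Color → Bool
marked white = false
marked gray  = true
marked black = true

unfinished : Color → ℕ
unfinished white = 1
unfinished gray  = 1
unfinished black = 0

marked-old : ∀ {c} → c ≢ white → fromBool (marked c) ≡ 1
marked-old {white} c≢white = contradiction refl c≢white
marked-old {gray}  _       = refl
marked-old {black} _       = refl

Mark : Memory → ℕ → Memory
Mark μ a = writeBits μ a 1 1

Mark-at : ∀ μ a → Mark μ a a ≡ true
Mark-at μ a = trans (cong (Mark μ a) (sym (+-identityʳ a))) (writeBits-inside μ a 1 1 0 (s≤s z≤n))

Mark-other : ∀ μ a {i} → i ≢ a → Mark μ a i ≡ μ i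
Mark-other μ a {i} i≢a with <-cmp i a
... | tri< i<a _ _ = writeBits-below μ a 1 1 i i<a
... | tri≈ _ i≡a _ = contradiction i≡a i≢a
... | tri> _ _ i>a = writeBits-above μ a 1 1 i (subst (_≤ i) (+-comm 1 a) i>a)

label-injective : ∀ {n} {x y : Fin n} → label x ≡ label y → x ≡ y
label-injective = Fin.toℕ-injective ∘ suc-injective

lookup-white⁻ : ∀ {n} (col : Vec Color n) {v x} c → c ≢ white →
  lookup (col [ v ]≔ c) x ≡ white → lookup col x ≡ white
lookup-white⁻ col {v} {x} c c≢white eq with x Fin.≟ v
... | yes refl = contradiction (trans (sym (lookup∘update v col c)) eq) c≢white
... | no x≢v   = trans (sym (lookup∘update′ x≢v col c)) eq

module Invariants {n : ℕ} (D : DirectedGraph n) where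
  open DirectedGraph D
  open DFS adjacency

  -- The gray path as a chain of tree edges. Both the path in a state of the DFS and the contents of
  -- the stack are functions of it.
  data Path (r : Fin n) : Fin n → Set where
    root : Path r r
    _▹_  : ∀ {u} → Path r u → (i : Fin (outdeg u)) → Path r (outhead u i)

  parentArc : ∀ {r u} → Path r u → Maybe Arc
  parentArc root            = nothing
  parentArc (_▹_ {u} π i) = just (u , i)

  mutual
    -- Separated from `trail⁻` so that the top entry is visible for an unanalysed path, as the DFS
    -- steps at the current vertex require.
    trail : ∀ {r u} → Path r u → List (Fin n × Maybe Arc)
    trail {u = u} π = (u , parentArc π) ∷ trail⁻ π

    trail⁻ : ∀ {r u} → Path r u → List (Fin n × Maybe Arc)
    trail⁻ root    = []
    trail⁻ (π ▹ i) = trail π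

  vertices : ∀ {r u} → Path r u → List (Fin n)
  vertices {r} root        = r ∷ []
  vertices (_▹_ {u} π i) = outhead u i ∷ vertices π

  root∈vertices : ∀ {r u} (π : Path r u) → r ∈ vertices π
  root∈vertices root    = here refl
  root∈vertices (π ▹ i) = there (root∈vertices π)

  current∈vertices : ∀ {r u} (π : Path r u) → u ∈ vertices π
  current∈vertices root    = here refl
  current∈vertices (π ▹ i) = here refl

  -- next x is the number of explored outgoing edges of x, which are its first ones.
  OnPath : Vec Color n → (Fin n → ℕ) → ∀ {r u} → Path r u → Set
  OnPath col next {r} root        = lookup col r ≡ gray
  OnPath col next (_▹_ {u} π i) =
    lookup col (outhead u i) ≡ gray × All (outhead u i ≢_) (vertices π) ×
    next u ≡ suc (toℕ i) × OnPath col next π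

  onPath-gray : ∀ {col next r u} (π : Path r u) → OnPath col next π →
    ∀ {x} → x ∈ vertices π → lookup col x ≡ gray
  onPath-gray root    is-gray       (here refl) = is-gray
  onPath-gray (π ▹ i) (is-gray , _) (here refl) = is-gray
  onPath-gray (π ▹ i) (_ , _ , _ , ok) (there x∈) = onPath-gray π ok x∈

  onPath-unique : ∀ {col next r u} (π : Path r u) → OnPath col next π → Unique (vertices π)
  onPath-unique root    _                   = [] ∷ []
  onPath-unique (π ▹ i) (_ , fresh , _ , ok) = fresh ∷ onPath-unique π ok

  onPath-≢root : ∀ {col next r u} (π : Path r u) i → OnPath col next (π ▹ i) → outhead u i ≢ r
  onPath-≢root π i (_ , fresh , _) = All.lookup fresh (root∈vertices π)

  onPath-cong : ∀ {col col′ next next′ r u} (π : Path r u) →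
    (∀ {x} → x ∈ vertices π → lookup col′ x ≡ lookup col x) →
    (∀ {x} → x ∈ vertices π → next′ x ≡ next x) →
    OnPath col next π → OnPath col′ next′ π
  onPath-cong root    col≡ next≡ is-gray = trans (col≡ (here refl)) is-gray
  onPath-cong (π ▹ i) col≡ next≡ (is-gray , fresh , at , ok) =
    trans (col≡ (here refl)) is-gray , fresh ,
    trans (next≡ (there (current∈vertices π))) at ,
    onPath-cong π (col≡ ∘ there) (next≡ ∘ there) ok

  -- `OnPath` restricts `next` only at vertices below the top, and freshness keeps these apart from
  -- the current vertex `u`, where `next` may change.
  onPath-update : ∀ {col col′ next next′ r u} (π : Path r u) →
    (∀ {x} → x ∈ vertices π → lookup col′ x ≡ lookup col x) →
    (∀ {x} → x ≢ u → next′ x ≡ next x) →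
    OnPath col next π → OnPath col′ next′ π
  onPath-update root    col≡ next≡ is-gray = trans (col≡ (here refl)) is-gray
  onPath-update (π ▹ i) col≡ next≡ (is-gray , fresh , at , ok) =
    trans (col≡ (here refl)) is-gray , fresh ,
    trans (next≡ (other (current∈vertices π))) at ,
    onPath-cong π (col≡ ∘ there) (next≡ ∘ other) ok
    where
    other : ∀ {x} → x ∈ vertices π → x ≢ _
    other x∈ = All.lookup fresh x∈ ∘ sym

  -- The function `next` exists only in the proof. The program holds its value at the current
  -- vertex; below the top it is determined by the tree edge, and at white vertices it is 0.
  record Inv (col : Vec Color n) (explored : List Arc) (next : Fin n → ℕ) (μ : Memory) : Set where
    field
      untouched : ∀ {x} → lookup col x ≡ white → next x ≡ 0
      sound     : ∀ {x i} → (x , i) ∈ explored → toℕ i < next x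
      complete  : ∀ {x i} → toℕ i < next x → (x , i) ∈ explored
      bits      : ∀ x → μ (label x) ≡ marked (lookup col x)

  inv-memory : ∀ {col ex next μ μ′} → (∀ i → i ≤ n → μ′ i ≡ μ i) →
    Inv col ex next μ → Inv col ex next μ′
  inv-memory same inv = record
    { Inv inv ; bits = λ x → trans (same (label x) (Fin.toℕ<n x)) (Inv.bits inv x) }

  inv-explore : ∀ {col ex next μ u} (i : Fin (outdeg u)) → next u ≡ toℕ i → lookup col u ≢ white →
    Inv col ex next μ → Inv col ((u , i) ∷ ex) (next [ u ↦ suc (toℕ i) ]) μ
  inv-explore {col} {ex} {next} {u = u} i at u≢white inv = record
    { untouched = untouched′ ; sound = sound′ ; complete = complete′ ; bits = bits }
    where
    open Inv inv
    next′ = next [ u ↦ suc (toℕ i) ]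
    next′-u : next′ u ≡ suc (toℕ i)
    next′-u = ↦-at next u _
    untouched′ : ∀ {x} → lookup col x ≡ white → next′ x ≡ 0
    untouched′ {x} x-white = trans (↦-other next _ λ { refl → u≢white x-white }) (untouched x-white)
    sound′ : ∀ {x k} → (x , k) ∈ (u , i) ∷ ex → toℕ k < next′ x
    sound′ (here refl) = ≤-reflexive (sym next′-u)
    sound′ {x} {k} (there k∈) with x Fin.≟ u
    ... | yes refl = m≤n⇒m≤1+n (subst (toℕ k <_) at (sound k∈))
    ... | no _     = sound k∈
    complete′ : ∀ {x k} → toℕ k < next′ x → (x , k) ∈ (u , i) ∷ ex
    complete′ {x} {k} k< with x Fin.≟ u
    ... | no _ = there (complete k<)
    ... | yes refl with m≤n⇒m<n∨m≡n (s≤s⁻¹ k<)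
    ...   | inj₁ k<i = there (complete (subst (toℕ k <_) (sym at) k<i))
    ...   | inj₂ k≡i = here (cong (u ,_) (Fin.toℕ-injective k≡i))

  inv-mark : ∀ {col ex next μ} v →
    Inv col ex next μ → Inv (col [ v ]≔ gray) ex next (Mark μ (label v))
  inv-mark {col} {ex} {next} {μ} v inv = record
    { Inv inv ; untouched = λ eq → Inv.untouched inv (lookup-white⁻ col gray (λ ()) eq) ; bits = bits′ }
    where
    bits′ : ∀ x → Mark μ (label v) (label x) ≡ marked (lookup (col [ v ]≔ gray) x)
    bits′ x with x Fin.≟ v
    ... | yes refl = trans (Mark-at μ (label v)) (cong marked (sym (lookup∘update v col gray)))
    ... | no x≢v   = trans (Mark-other μ (label v) (x≢v ∘ label-injective))
      (trans (Inv.bits inv x) (cong marked (sym (lookup∘update′ x≢v col gray))))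

  inv-finish : ∀ {col ex next μ} v → lookup col v ≡ gray →
    Inv col ex next μ → Inv (col [ v ]≔ black) ex next μ
  inv-finish {col} {ex} {next} {μ} v v-gray inv = record
    { Inv inv ; untouched = λ eq → Inv.untouched inv (lookup-white⁻ col black (λ ()) eq) ; bits = bits′ }
    where
    bits′ : ∀ x → μ (label x) ≡ marked (lookup (col [ v ]≔ black) x)
    bits′ x with x Fin.≟ v
    ... | yes refl = trans (Inv.bits inv v)
      (trans (cong marked v-gray) (cong marked (sym (lookup∘update v col black))))
    ... | no x≢v   = trans (Inv.bits inv x) (cong marked (sym (lookup∘update′ x≢v col black)))

  load-mark : ∀ {col ex next μ} → Inv col ex next μ → ∀ x →
    readBits μ (label x) 1 ≡ fromBool (marked (lookup col x))
  load-mark inv x = trans (cong (λ b → fromBool b + 0) (Inv.bits inv x)) (+-identityʳ _)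

  weight : Vec Color n → (Fin n → ℕ) → Fin n → ℕ
  weight col next x = (outdeg x ∸ next x) + unfinished (lookup col x)

  -- The number of iterations of `visit` still to come: one for each unexplored outgoing edge and
  -- one for each vertex that is not yet black.
  Φ : Vec Color n → (Fin n → ℕ) → ℕ
  Φ col next = Σ[ weight col next ]

  unfinished-≤ : ∀ (col : Vec Color n) v → lookup col v ≡ white → ∀ x →
    unfinished (lookup (col [ v ]≔ gray) x) ≤ unfinished (lookup col x)
  unfinished-≤ col v v-white x with x Fin.≟ v
  ... | yes refl rewrite lookup∘update v col gray | v-white = ≤-refl
  ... | no x≢v rewrite lookup∘update′ x≢v col gray = ≤-refl

  Φ-newRoot : ∀ col next v → lookup col v ≡ white → Φ (col [ v ]≔ gray) next ≤ Φ col next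
  Φ-newRoot col next v v-white =
    Σ-mono λ x → +-monoʳ-≤ (outdeg x ∸ next x) (unfinished-≤ col v v-white x)

  Φ-explore : ∀ {col col′ next} u (i : Fin (outdeg u)) → next u ≡ toℕ i →
    (∀ x → unfinished (lookup col′ x) ≤ unfinished (lookup col x)) →
    suc (Φ col′ (next [ u ↦ suc (toℕ i) ])) ≤ Φ col next
  Φ-explore {col} {col′} {next} u i at col≤ = Σ-gap u 1
    (λ y y≢u → +-mono-≤ (≤-reflexive (cong (outdeg y ∸_) (↦-other next _ y≢u))) (col≤ y))
    (≤-trans (+-monoˡ-≤ (unfinished (lookup col′ u)) (≤-reflexive (begin
      suc (outdeg u ∸ (next [ u ↦ suc (toℕ i) ]) u) ≡⟨ cong (λ k → suc (outdeg u ∸ k)) (↦-at next u _) ⟩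
      suc (outdeg u ∸ suc (toℕ i))                 ≡⟨ +-∸-assoc 1 (Fin.toℕ<n i) ⟨
      outdeg u ∸ toℕ i                             ≡⟨ cong (outdeg u ∸_) at ⟨
      outdeg u ∸ next u                            ∎)))
      (+-monoʳ-≤ (outdeg u ∸ next u) (col≤ u)))
    where open ≡-Reasoning

  Φ-finish : ∀ col next v → lookup col v ≡ gray → suc (Φ (col [ v ]≔ black) next) ≤ Φ col next
  Φ-finish col next v v-gray = Σ-gap v 1
    (λ y y≢v → ≤-reflexive (cong (λ c → (outdeg y ∸ next y) + unfinished c) (lookup∘update′ y≢v col black)))
    at-v
    where
    at-v : 1 + weight (col [ v ]≔ black) next v ≤ weight col next v
    at-v rewrite lookup∘update v col black | v-gray = ≤-reflexive (sym (+-suc (outdeg v ∸ next v) 0))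

-- Correctness and running time of the search

module SearchExecution {S : Signature} (F : Interface S) {n : ℕ} (D : DirectedGraph n) (I : Input S)
                       (w b M : ℕ) (b≤w : b ≤ w) (14≤b : 14 ≤ b) (M<2^b : M < 2 ^ b)
                       (correct : Correct F D I w b M) where
  open DirectedGraph D
  open DFS adjacency
  open Invariants D
  open FrameStack F D I w b M b≤w 14≤b M<2^b correct
  open Traversal F

  -- The clauses look two edges deep because a vertex receives its frame only when its child is
  -- known: the position `i` of the child enters the encoding.
  frames : ∀ {r u} → Path r u → List (ℕ × ℕ)
  frames root       = []
  frames (root ▹ i) = []
  frames (π@(_▹_ {x} _ k) ▹ i) = frame (outhead x k) (outmate x k) i ∷ frames π

  ParentAt : ∀ {r u} → Path r u → ℕ → Set
  ParentAt root          p = ⊤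
  ParentAt (_▹_ {u} _ i) p = p ≡ toℕ (outmate u i)

  frames-≤ : ∀ {r u} (π : Path r u) i →
    sum (map proj₁ (frames (π ▹ i))) ≤ sum (map keyOf (vertices π))
  frames-≤ root               i = z≤n
  frames-≤ (_▹_ {x} π k) i = +-monoʳ-≤ (keyOf (outhead x k)) (frames-≤ π k)

  -- The vertices of the path are distinct, so the keys of their frames add up to at most the sum
  -- over all vertices, for which `enough` reserves the space.
  frames-fit : ∀ {col next r u} (π : Path r u) i → OnPath col next π →
    demand n (frames (π ▹ i)) ≤ 5 * M + 4
  frames-fit π i ok = ≤-trans
    (+-monoʳ-≤ (5 * suc n) (*-monoʳ-≤ 2 (≤-trans (frames-≤ π i) (Σ-unique keyOf (onPath-unique π ok)))))
    enough

  label≤n : ∀ (x : Fin n) → label x ≤ n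
  label≤n = Fin.toℕ<n

  label< : ∀ (x : Fin n) → label x < 2 ^ b
  label< x = ≤-<-trans (label≤n x) n<2^b

  1≤w : 1 ≤ w
  1≤w = ≤-trans (≤-trans (s≤s z≤n) 14≤b) b≤w

  mark-inside : ∀ (x : Fin n) → InMemory (label x) 1
  mark-inside x = 1≤w , ≤-trans (≤-reflexive (+-comm (label x) 1)) (≤-trans (s≤s (label≤n x)) n<M)

  rep-mark : ∀ {fs σ μ} (x : Fin n) → Rep fs σ μ → Rep fs σ (Mark μ (label x))
  rep-mark {μ = μ} x = rep-cong {μ = μ} λ i n<i → Mark-other μ (label x) λ { refl → <⇒≱ n<i (label≤n x) }


  gray≢white : ∀ (col : Vec Color n) {x y} → lookup col x ≡ gray → lookup col y ≡ white → x ≢ y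
  gray≢white _ x-gray y-white refl with () ← trans (sym x-gray) y-white

  -- Bundles the comparison with the root and the conditional push, so that the surrounding run is
  -- treated once for both outcomes.
  Descended : ∀ {r u} (π : Path r u) → Fin (outdeg u) → (p v : ℕ) → Vec ℕ 13 → Memory → Set
  Descended {r} {u} π i p v σ μ =
    ∃[ t ] ∃[ T ] ∃[ t′ ] ∃[ σ′ ] ∃[ μ′ ] T ≤ 41 ×
      (∀ {t₀} → Exec (t# := op Op.eq (reg u#) (reg r#)) (main (label u) p (toℕ i) (label r) t₀ v σ μ) 1 []
        (main (label u) p (toℕ i) (label r) t v σ μ)) ×
      Exec (cond (reg t#) skip pushFrame) (main (label u) p (toℕ i) (label r) t v σ μ) T []
        (main (label u) p (toℕ i) (label r) t′ v σ′ μ′) ×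
      Rep (frames (π ▹ i)) σ′ μ′ × (∀ k → k ≤ n → μ′ k ≡ μ k)

  descend : ∀ {col next r u} (π : Path r u) (i : Fin (outdeg u)) {p v σ μ} → OnPath col next π →
    lookup col (outhead u i) ≡ white → ParentAt π p → Rep (frames π) σ μ → Descended π i p v σ μ
  descend root i _ _ _ stack =
    _ , _ , _ , _ , _ , ≤ᵇ⇒≤ 2 41 tt , set-eq-yes refl refl refl , cond-true (λ ()) skip , stack , λ _ _ → refl
  descend {col} {r = r} π@(_▹_ {x} π₀ k) i {v = v} {σ} {μ} ok new-white refl stack =
    after (push-exec (outhead x k) (outmate x k) i differ stack (frames-fit π i ok))
    where
    differ : inhead (outhead x k) (outmate x k) ≢ outhead (outhead x k) i
    -- The parent lies on the gray path, whereas the child is still white.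
    differ = subst (_≢ _) (sym (head-outmate x k))
      (gray≢white col (onPath-gray π ok (there (current∈vertices π₀))) new-white)
    after : Pushed (label (outhead x k)) (toℕ (outmate x k)) (toℕ i) (label r) 0 v σ μ (frames (π ▹ i)) →
      Descended π i (toℕ (outmate x k)) v σ μ
    after (_ , _ , _ , _ , T≤ , exec , stack′ , same) =
      _ , _ , _ , _ , _ , s≤s T≤ ,
      set-eq-no refl refl (onPath-≢root π₀ k ok ∘ label-injective) , cond-false refl exec , stack′ , same

  Ascended : ∀ {r u} (π : Path r u) → Fin (outdeg u) → (p v : ℕ) → Vec ℕ 13 → Memory → Set
  Ascended {r} {u} π i p v σ μ =
    ∃[ t ] ∃[ T ] ∃[ t′ ] ∃[ p′ ] ∃[ σ′ ] T ≤ 41 ×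
      (∀ {t₀} → Exec (t# := op Op.eq (reg u#) (reg r#)) (main (label u) p (toℕ i) (label r) t₀ v σ μ) 1 []
        (main (label u) p (toℕ i) (label r) t v σ μ)) ×
      Exec (cond (reg t#) skip popFrame) (main (label u) p (toℕ i) (label r) t v σ μ) T []
        (main (label u) p′ (toℕ i) (label r) t′ v σ′ μ) ×
      Rep (frames π) σ′ μ × ParentAt π p′

  ascend : ∀ {col next r u} (π : Path r u) (i : Fin (outdeg u)) {p v σ μ} → OnPath col next (π ▹ i) →
    Rep (frames (π ▹ i)) σ μ → Ascended π i p v σ μ
  ascend root i _ stack =
    _ , _ , _ , _ , _ , ≤ᵇ⇒≤ 2 41 tt , set-eq-yes refl refl refl , cond-true (λ ()) skip , stack , tt
  ascend {r = r} π@(_▹_ {x} π₀ k) i {p} {v} {σ} {μ} (_ , fresh , _ , ok) stack =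
    after (pop-exec (outhead x k) (outmate x k) i differ stack (frames-fit π i ok))
    where
    differ : inhead (outhead x k) (outmate x k) ≢ outhead (outhead x k) i
    -- Here the child is gray too; it differs from the parent because the path has no repeated
    -- vertex.
    differ eq = All.lookup fresh (there (current∈vertices π₀)) (trans (sym eq) (head-outmate x k))
    after : Popped (label (outhead x k)) p (toℕ i) (label r) 0 v σ μ (toℕ (outmate x k)) (frames π) →
      Ascended π i p v σ μ
    after (_ , _ , _ , T≤ , exec , stack′) =
      _ , _ , _ , _ , _ , s≤s T≤ ,
      set-eq-no refl refl (onPath-≢root π₀ k ok ∘ label-injective) , cond-false refl exec , stack′ , refl

  -- An upper bound on the time of one iteration of `visit` with its loop test; the conditional
  -- operation on the stack takes at most 41 units of it.
  cost : ℕ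
  cost = 70

  -- The potential left at the end stays in `bound`, since the later trees are paid from it. The
  -- additional unit is the last loop test.
  record Searched (s : Config registerCount) (S : State) (rs : List (Fin n)) (r Φ₀ : ℕ) : Set where
    field
      {time}   : ℕ
      {events} : List Event
      {u p j t v} : ℕ
      {σ}      : Vec ℕ 13
      {μ}      : Memory
      {col}    : Vec Color n
      {ex}     : List Arc
      {next}   : Fin n → ℕ
      run      : Exec (while (reg t#) visit) s time events (main u p j r t v σ μ)
      steps    : Steps S events (state rs col ex [])
      inv      : Inv col ex next μ
      stack    : Rep [] σ μ
      bound    : time + cost * Φ col next ≤ suc (cost * Φ₀)

  charge : ∀ {T t Φ₁ Φ₀ X} → suc T ≤ cost → suc Φ₁ ≤ Φ₀ → t + X ≤ suc (cost * Φ₁) →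
    suc (T + t) + X ≤ suc (cost * Φ₀)
  charge {T} {t} {Φ₁} {Φ₀} {X} T< Φ< t≤ = begin
    suc (T + t) + X            ≡⟨ cong suc (+-assoc T t X) ⟩
    suc T + (t + X)            ≤⟨ +-mono-≤ T< t≤ ⟩
    cost + suc (cost * Φ₁)     ≡⟨ +-suc cost (cost * Φ₁) ⟩
    suc (cost + cost * Φ₁)     ≡⟨ cong suc (*-suc cost Φ₁) ⟨
    suc (cost * suc Φ₁)        ≤⟨ s≤s (*-monoʳ-≤ cost Φ<) ⟩
    suc (cost * Φ₀)            ∎
    where open ≤-Reasoning

  continue : ∀ {s s′ S S′ rs r T es Φ₁ Φ₀} → value s (reg t#) ≢ 0 → Exec visit s T es s′ → suc T ≤ cost →
    Step S es S′ → suc Φ₁ ≤ Φ₀ → Searched s′ S′ rs r Φ₁ → Searched s S rs r Φ₀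
  continue t≢0 exec T< step Φ< rest = record
    { run = while-true t≢0 exec run ; steps = step ∷ steps ; inv = inv ; stack = stack
    ; bound = charge T< Φ< bound }
    where open Searched rest

  stop : ∀ {rs u p j r v σ μ col ex next} → Inv col ex next μ → Rep [] σ μ →
    Searched (main u p j r 0 v σ μ) (state rs col ex []) rs r (Φ col next)
  stop inv stack = record
    { run = while-false refl ; steps = [] ; inv = inv ; stack = stack ; bound = ≤-refl }

  outdeg< : ∀ u → outdeg u < 2 ^ b
  outdeg< u = ≤-<-trans (outdeg≤n D u) n<2^b

  step< : ∀ {u} (i : Fin (outdeg u)) → suc (toℕ i) < 2 ^ b
  step< {u} i = ≤-<-trans (Fin.toℕ<n i) (outdeg< u)

  old-exec : ∀ {col ex next u p r v σ μ} (i : Fin (outdeg u)) → Inv col ex next μ →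
    lookup col (outhead u i) ≢ white → ∃[ v′ ]
    Exec visit (main (label u) p (toℕ i) r 1 v σ μ) 9 (onArc exploreToOld (u , i) ∷ [])
      (main (label u) p (suc (toℕ i)) r 1 v′ σ μ)
  old-exec {col} {u = u} i inv head-old = _ ,
    (set-access₁ refl (outdeg≡ u) (outdeg< u) ⨾
     set-lt-yes refl refl (Fin.toℕ<n i) ⨾
     cond-true (λ ())
       (set-access₂ refl refl (outhead≡ u i) (label< (outhead u i)) ⨾
        set-load refl (constant 1) (mark-inside (outhead u i))
          (trans (load-mark inv (outhead u i)) (marked-old head-old)) (small 1) ⨾
        cond-true (λ ())
          (call₂ ⨾ set-add refl (constant 1) (+-comm (toℕ i) 1) (step< i) ⨾ set (constant 1) (small 1))))

  NewVisited : ∀ {r u} (π : Path r u) → Fin (outdeg u) → (p v : ℕ) → Vec ℕ 13 → Memory → Set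
  NewVisited {r} {u} π i p v σ μ =
    ∃[ T ] ∃[ v′ ] ∃[ σ′ ] ∃[ μ′ ] suc T ≤ cost ×
      Exec visit (main (label u) p (toℕ i) (label r) 1 v σ μ) T
        (onArc exploreToNew (u , i) ∷ onVertex turnsGray (outhead u i) ∷ [])
        (main (label (outhead u i)) (toℕ (outmate u i)) 0 (label r) 1 v′ σ′ μ′) ×
      Rep (frames (π ▹ i)) σ′ μ′ ×
      (∀ k → k ≤ n → μ′ k ≡ Mark μ (label (outhead u i)) k)

  new-exec : ∀ {col ex next r u p v σ μ} (π : Path r u) (i : Fin (outdeg u)) → Inv col ex next μ →
    lookup col (outhead u i) ≡ white →
    Descended π i p (label (outhead u i)) σ (Mark μ (label (outhead u i))) →
    NewVisited π i p v σ μ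
  new-exec {col} {u = u} {σ = σ} {μ} π i inv head-new (_ , _ , _ , _ , _ , T≤ , test , exec , stack , same) =
    _ , _ , _ , _ , within 11 4 cost T≤ ,
    (set-access₁ refl (outdeg≡ u) (outdeg< u) ⨾
     set-lt-yes refl refl (Fin.toℕ<n i) ⨾
     cond-true (λ ())
       (set-access₂ refl refl (outhead≡ u i) (label< (outhead u i)) ⨾
        set-load refl (constant 1) (mark-inside (outhead u i))
          (trans (load-mark inv (outhead u i)) (cong (fromBool ∘ marked) head-new)) (small 0) ⨾
        cond-false refl
          (call₂ ⨾ call₁ ⨾
           put refl (constant 1) (constant 1) (mark-inside (outhead u i)) ⨾
           test ⨾ exec ⨾
           set-access₂ refl refl (outmate≡ u i) (<-trans (toℕ-in< (outmate u i)) n<2^b) ⨾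
           set refl (label< (outhead u i)) ⨾
           set (constant 0) (small 0) ⨾
           set (constant 1) (small 1)))) ,
    stack , same

  root-exec : ∀ {r p j v σ μ} → outdeg r ≤ j → ∃[ v′ ]
    Exec visit (main (label r) p j (label r) 1 v σ μ) 7 (onVertex turnsBlack r ∷ [])
      (main (label r) p j (label r) 0 v′ σ μ)
  root-exec {r} done = _ ,
    (set-access₁ refl (outdeg≡ r) (outdeg< r) ⨾
     set-lt-no refl refl done ⨾
     cond-false refl
       (call₁ ⨾ set-eq-yes refl refl refl ⨾ cond-true (λ ()) (set (constant 0) (small 0))))

  Retreated : ∀ {r u} (π : Path r u) → Fin (outdeg u) → (p j v : ℕ) → Vec ℕ 13 → Memory → Set
  Retreated {r} {u} π i p j v σ μ =
    ∃[ T ] ∃[ p′ ] ∃[ v′ ] ∃[ σ′ ] suc T ≤ cost ×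
      Exec visit (main (label (outhead u i)) p j (label r) 1 v σ μ) T
        (onVertex turnsBlack (outhead u i) ∷ onArc withdraw (u , i) ∷ [])
        (main (label u) p′ (suc (toℕ i)) (label r) 1 v′ σ′ μ) ×
      Rep (frames π) σ′ μ × ParentAt π p′

  retreat-exec : ∀ {r u j v σ μ} (π : Path r u) (i : Fin (outdeg u)) → outdeg (outhead u i) ≤ j →
    outhead u i ≢ r →
    Ascended π i (toℕ (outmate u i)) (label u) σ μ → Retreated π i (toℕ (outmate u i)) j v σ μ
  retreat-exec {r} {u} π i done not-root (_ , _ , _ , _ , _ , T≤ , test , exec , stack , parent) =
    _ , _ , _ , _ , within 12 2 cost T≤ ,
    (set-access₁ refl (outdeg≡ (outhead u i)) (outdeg< (outhead u i)) ⨾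
     set-lt-no refl refl done ⨾
     cond-false refl
       (call₁ ⨾
        set-eq-no refl refl (not-root ∘ label-injective) ⨾
        cond-false refl
          (set-access₂ refl refl
             (trans (inhead≡ _ (outmate u i)) (cong (just ∘ label) (head-outmate u i))) (label< u) ⨾
           set-access₂ refl refl
             (trans (inmate≡ _ (outmate u i)) (cong (λ a → just (toℕ (proj₂ a))) (reverse-≡ D u i)))
             (<-trans (toℕ-out< i) n<2^b) ⨾
           set refl (label< u) ⨾
           call₂ ⨾
           test ⨾ exec ⨾
           set-add refl (constant 1) (+-comm (toℕ i) 1) (step< i) ⨾
           set (constant 1) (small 1)))) ,
    stack , parent

  data Position (d : ℕ) : ℕ → Set where
    at   : (i : Fin d) → Position d (toℕ i)
    past : ∀ {j} → d ≤ j → Position d j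

  position : ∀ d j → Position d j
  position d j with <-≤-connex j d
  ... | inj₁ j<d = subst (Position d) (Fin.toℕ-fromℕ< j<d) (at (fromℕ< j<d))
  ... | inj₂ d≤j = past d≤j

  all-explored : ∀ {col ex next μ u} → Inv col ex next μ → outdeg u ≤ next u → ∀ i → (u , i) ∈ ex
  all-explored inv d≤ i = Inv.complete inv (<-≤-trans (Fin.toℕ<n i) d≤)

  unexplored : ∀ {col ex next μ u} {i : Fin (outdeg u)} → Inv col ex next μ → next u ≡ toℕ i → (u , i) ∉ ex
  unexplored inv next≡ ui∈ = <-irrefl (sym next≡) (Inv.sound inv ui∈)

  white? : ∀ (c : Color) → Dec (c ≡ white)
  white? white = yes refl
  white? gray  = no λ ()
  white? black = no λ ()

  gray-not-white : ∀ {c} → c ≡ gray → c ≢ white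
  gray-not-white refl ()

  SearchedFrom : ∀ {r u} → Path r u → (col : Vec Color n) → List Arc → (Fin n → ℕ) → List (Fin n) →
    (j p v : ℕ) → Vec ℕ 13 → Memory → Set
  SearchedFrom {r} {u} π col ex next rs j p v σ μ =
    Searched (main (label u) p j (label r) 1 v σ μ) (state rs col ex (trail π)) rs (label r) (Φ col next)

  -- The path grows and shrinks, so the recursion is on the potential, which falls in every
  -- iteration.
  searchLoop : ∀ {r u} (π : Path r u) {rs col ex next μ p v σ j} → Acc _<_ (Φ col next) →
    next u ≡ j → Inv col ex next μ → OnPath col next π → ParentAt π p → Rep (frames π) σ μ →
    SearchedFrom π col ex next rs j p v σ μ
  searchLoop {r} {u} π {rs} {col} {ex} {next} {μ} {p} {v} {σ} {j} (acc smaller) next≡ inv ok parent stack =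
    go (position (outdeg u) j) next≡
    where
    current-gray : lookup col u ≡ gray
    current-gray = onPath-gray π ok (current∈vertices π)

    old : (i : Fin (outdeg u)) → next u ≡ toℕ i → lookup col (outhead u i) ≢ white →
      SearchedFrom π col ex next rs (toℕ i) p v σ μ
    old i next≡ head-old with old-exec {r = label r} i inv head-old
    ... | _ , exec = continue (λ ()) exec (≤ᵇ⇒≤ 10 cost tt)
      (toOld i (unexplored inv next≡) head-old) decrease
      (searchLoop π (smaller decrease) (↦-at next u _)
        (inv-explore i next≡ (gray-not-white current-gray) inv)
        (onPath-update {col} {col} π (λ _ → refl) (↦-other next _) ok) parent stack)
      where
      decrease : suc (Φ col (next [ u ↦ suc (toℕ i) ])) ≤ Φ col next
      decrease = Φ-explore {col} {col} u i next≡ (λ _ → ≤-refl)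

    new : (i : Fin (outdeg u)) → next u ≡ toℕ i → lookup col (outhead u i) ≡ white →
      NewVisited π i p v σ μ → SearchedFrom π col ex next rs (toℕ i) p v σ μ
    new i next≡ head-new (_ , _ , _ , _ , T≤ , exec , stack′ , same) = continue (λ ()) exec T≤
      (toNew i (unexplored inv next≡) head-new) decrease
      (searchLoop (π ▹ i) (smaller decrease)
        -- A white vertex has no explored edges, in agreement with the value 0 given to j.
        (trans (↦-other next _ x≢u) (Inv.untouched inv head-new))
        (inv-memory same (inv-explore i next≡ u-old (inv-mark x inv)))
        (lookup∘update x col gray , All.tabulate (λ y∈ → x≢ y∈ ∘ sym) , ↦-at next u _ ,
          onPath-update {col} {col [ x ]≔ gray} π (λ y∈ → lookup∘update′ (x≢ y∈) col gray) (↦-other next _) ok)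
        refl stack′)
      where
      x : Fin n
      x = outhead u i
      x≢ : ∀ {y} → y ∈ vertices π → y ≢ x
      x≢ y∈ = gray≢white col (onPath-gray π ok y∈) head-new
      x≢u : x ≢ u
      x≢u = x≢ (current∈vertices π) ∘ sym
      u-old : lookup (col [ x ]≔ gray) u ≢ white
      u-old white′ = gray-not-white current-gray (lookup-white⁻ col gray (λ ()) white′)
      decrease : suc (Φ (col [ x ]≔ gray) (next [ u ↦ suc (toℕ i) ])) ≤ Φ col next
      decrease = Φ-explore {col} {col [ x ]≔ gray} u i next≡ (unfinished-≤ col x head-new)

    go : ∀ {j} → Position (outdeg u) j → next u ≡ j → SearchedFrom π col ex next rs j p v σ μ
    go (at i) next≡ with white? (lookup col (outhead u i))
    ... | no head-old  = old i next≡ head-old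
    ... | yes head-new = new i next≡ head-new (new-exec π i inv head-new
      (descend π i ok head-new parent (rep-mark (outhead u i) stack)))
    go (past d≤j) refl = leave π smaller inv ok parent stack d≤j
      where
      -- Stated for an arbitrary path, so that it can be analysed: at a root the tree is complete,
      -- otherwise the search withdraws.
      leave : ∀ {u} (π : Path r u) → (∀ {k} → k < Φ col next → Acc _<_ k) →
        Inv col ex next μ → OnPath col next π → ParentAt π p → Rep (frames π) σ μ →
        outdeg u ≤ next u → SearchedFrom π col ex next rs (next u) p v σ μ
      leave root smaller inv ok _ stack d≤ with root-exec d≤
      ... | _ , exec = continue (λ ()) exec (≤ᵇ⇒≤ 8 cost tt) (finish (all-explored inv d≤))
        (Φ-finish col next r ok) (stop (inv-finish r ok inv) stack)
      leave (_▹_ {x} π i) smaller inv ok@(is-gray , fresh , next≡ , ok′) refl stack d≤ =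
        after (retreat-exec π i d≤ (onPath-≢root π i ok) (ascend π i ok stack))
        where
        decrease : suc (Φ (col [ outhead x i ]≔ black) next) ≤ Φ col next
        decrease = Φ-finish col next (outhead x i) is-gray
        after : Retreated π i (toℕ (outmate x i)) (next (outhead x i)) v σ μ →
          SearchedFrom (π ▹ i) col ex next rs (next (outhead x i)) (toℕ (outmate x i)) v σ μ
        after (_ , _ , _ , _ , T≤ , exec , stack′ , parent′) = continue (λ ()) exec T≤
          (finish (all-explored inv d≤)) decrease
          -- The path records the tree edge as the last explored edge of the parent, so position
          -- `suc (toℕ i)` is where its exploration continues.
          (searchLoop π (smaller decrease) next≡ (inv-finish _ is-gray inv)
            (onPath-cong {col} {col [ outhead x i ]≔ black} π
              (λ y∈ → lookup∘update′ (All.lookup fresh y∈ ∘ sym) col black) (λ _ → refl) ok′)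
            parent′ stack′)

  -- The loop over the roots and the initialization

  steps-++ : ∀ {S S′ S″ es es′} → Steps S es S′ → Steps S′ es′ S″ → Steps S (es ++ es′) S″
  steps-++ [] steps′ = steps′
  steps-++ {es′ = es′} (_∷_ {es = es₁} {es₂} step steps) steps′ =
    subst (λ es → Steps _ es _) (sym (List.++-assoc es₁ es₂ es′)) (step ∷ steps-++ steps steps′)

  -- Links the root counter to the remaining roots. Labels are one larger than indices, so before
  -- the increment the counter equals the index of the next root.
  data Consecutive : ℕ → List (Fin n) → Set where
    []  : Consecutive n []
    _∷_ : ∀ x {xs} → Consecutive (label x) xs → Consecutive (toℕ x) (x ∷ xs)

  consecutive-tabulate : ∀ k {m} (f : Fin m → Fin n) → k + m ≡ n → (∀ i → toℕ (f i) ≡ k + toℕ i) →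
    Consecutive k (tabulate f)
  consecutive-tabulate k {zero} f k+m≡n f≡ =
    subst (λ k → Consecutive k []) (trans (sym k+m≡n) (+-identityʳ k)) []
  consecutive-tabulate k {suc m} f k+m≡n f≡ =
    subst (λ k → Consecutive k (tabulate f)) (trans (f≡ zero) (+-identityʳ k))
      (f zero ∷ consecutive-tabulate (label (f zero)) (f ∘ suc)
        (trans (cong (λ l → suc l + m) start≡) (trans (sym (+-suc k m)) k+m≡n))
        (λ i → trans (f≡ (suc i)) (trans (+-suc k (toℕ i)) (cong (λ l → suc l + toℕ i) (sym start≡)))))
    where
    start≡ : toℕ (f zero) ≡ k
    start≡ = trans (f≡ zero) (+-identityʳ k)

  nonempty : List (Fin n) → ℕ
  nonempty []      = 0
  nonempty (_ ∷ _) = 1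

  test-exec : ∀ {u p j r t v σ μ rs} → Consecutive r rs →
    Exec (t# := op Op.lt (reg r#) size) (main u p j r t v σ μ) 1 [] (main u p j r (nonempty rs) v σ μ)
  test-exec []       = set-lt-no refl size≡ ≤-refl
  test-exec (x ∷ _) = set-lt-yes refl size≡ (Fin.toℕ<n x)

  record Traversed (s : Config registerCount) (S : State) (B : ℕ) : Set where
    field
      {time}   : ℕ
      {events} : List Event
      {end}    : Config registerCount
      {col}    : Vec Color n
      {ex}     : List Arc
      run      : Exec (while (reg t#) search) s time events end
      steps    : Steps S events (state [] col ex [])
      bound    : time ≤ B

  -- Twenty units per root cover the work outside its tree; the trees are paid for by the potential.
  rootBudget : ℕ → List (Fin n) → ℕ
  rootBudget Φ₀ rs = suc (20 * length rs + cost * Φ₀)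

  private
    budget-skip : ∀ {t} l X → t ≤ suc (20 * l + X) → suc (5 + t) ≤ suc (20 * suc l + X)
    budget-skip {t} l X t≤ = s≤s (begin
      5 + t                      ≤⟨ +-monoʳ-≤ 5 t≤ ⟩
      6 + (20 * l + X)           ≤⟨ +-monoˡ-≤ (20 * l + X) (≤ᵇ⇒≤ 6 20 tt) ⟩
      20 + (20 * l + X)          ≡⟨ lemma l X ⟩
      20 * suc l + X             ∎)
      where
      open ≤-Reasoning
      lemma : ∀ l X → 20 + (20 * l + X) ≡ 20 * suc l + X
      lemma = solve-∀

    budget-root : ∀ {t t′ Φ₀ Φ₁ Φ₂} l → t + cost * Φ₂ ≤ suc (cost * Φ₁) → Φ₁ ≤ Φ₀ →
      t′ ≤ suc (20 * l + cost * Φ₂) → suc ((8 + (t + 1)) + t′) ≤ suc (20 * suc l + cost * Φ₀)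
    budget-root {t} {t′} {Φ₀} {Φ₁} {Φ₂} l t≤ Φ≤ t′≤ = s≤s (begin
      (8 + (t + 1)) + t′                        ≤⟨ +-monoʳ-≤ (8 + (t + 1)) t′≤ ⟩
      (8 + (t + 1)) + suc (20 * l + cost * Φ₂)  ≡⟨ lemma₁ t l (cost * Φ₂) ⟩
      10 + 20 * l + (t + cost * Φ₂)             ≤⟨ +-monoʳ-≤ (10 + 20 * l) t≤ ⟩
      10 + 20 * l + suc (cost * Φ₁)             ≤⟨ +-monoʳ-≤ (10 + 20 * l) (s≤s (*-monoʳ-≤ cost Φ≤)) ⟩
      10 + 20 * l + suc (cost * Φ₀)             ≡⟨ lemma₂ l (cost * Φ₀) ⟩
      11 + (20 * l + cost * Φ₀)                 ≤⟨ +-monoˡ-≤ (20 * l + cost * Φ₀) (≤ᵇ⇒≤ 11 20 tt) ⟩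
      20 + (20 * l + cost * Φ₀)                 ≡⟨ lemma₃ l (cost * Φ₀) ⟩
      20 * suc l + cost * Φ₀                    ∎)
      where
      open ≤-Reasoning
      lemma₁ : ∀ t l X → (8 + (t + 1)) + suc (20 * l + X) ≡ 10 + 20 * l + (t + X)
      lemma₁ = solve-∀
      lemma₂ : ∀ l X → 10 + 20 * l + suc X ≡ 11 + (20 * l + X)
      lemma₂ = solve-∀
      lemma₃ : ∀ l X → 20 + (20 * l + X) ≡ 20 * suc l + X
      lemma₃ = solve-∀

  searchRoots : ∀ {k rs col ex next u p j v σ μ} → Consecutive k rs → Inv col ex next μ → Rep [] σ μ →
    Traversed (main u p j k (nonempty rs) v σ μ) (state rs col ex []) (rootBudget (Φ col next) rs)
  searchRoots [] inv stack = record { run = while-false refl ; steps = [] ; bound = s≤s z≤n }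
  searchRoots {rs = x ∷ rs} {col} {ex} {next} {u} {p} {j} {v} {σ} {μ} (.x ∷ next-roots) inv stack =
    go (white? (lookup col x))
    where
    Goal : Set
    Goal = Traversed (main u p j (toℕ x) 1 v σ μ) (state (x ∷ rs) col ex []) (rootBudget (Φ col next) (x ∷ rs))

    skipped : lookup col x ≢ white →
      Traversed (main u p j (label x) (nonempty rs) v σ μ) (state rs col ex [])
        (rootBudget (Φ col next) rs) → Goal
    skipped x-old rest = record
      { run = while-true (λ ())
          (set-add refl (constant 1) (+-comm (toℕ x) 1) (label< x) ⨾
           set-load refl (constant 1) (mark-inside x) (trans (load-mark inv x) (marked-old x-old)) (small 1) ⨾
           cond-true (λ ()) skip ⨾
           test-exec next-roots)
          R.run
      ; steps = skipRoot x-old ∷ R.steps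
      ; bound = budget-skip (length rs) (cost * Φ col next) R.bound }
      where module R = Traversed rest

    searched : lookup col x ≡ white →
      SearchedFrom (root {x}) (col [ x ]≔ gray) ex next rs 0 p v σ (Mark μ (label x)) → Goal
    searched x-new tree = finally (searchRoots next-roots T.inv T.stack)
      where
      module T = Searched tree
      finally : Traversed (main T.u T.p T.j (label x) (nonempty rs) T.v T.σ T.μ) (state rs T.col T.ex [])
        (rootBudget (Φ T.col T.next) rs) → Goal
      finally rest = record
        { run = while-true (λ ())
            (set-add refl (constant 1) (+-comm (toℕ x) 1) (label< x) ⨾
             set-load refl (constant 1) (mark-inside x)
               (trans (load-mark inv x) (cong (fromBool ∘ marked) x-new)) (small 0) ⨾
             cond-false refl
               (put refl (constant 1) (constant 1) (mark-inside x) ⨾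
                call₁ ⨾
                set refl (label< x) ⨾
                set (constant 0) (small 0) ⨾
                set (constant 1) (small 1) ⨾
                T.run) ⨾
             test-exec next-roots)
            R.run
        ; steps = newRoot x-new ∷ steps-++ (steps-++ T.steps []) R.steps
        ; bound = budget-root {T.time} {Φ₂ = Φ T.col T.next} (length rs) T.bound
            (Φ-newRoot col next x x-new) R.bound }
        where module R = Traversed rest

    go : Dec (lookup col x ≡ white) → Goal
    go (no x-old) = skipped x-old (searchRoots next-roots inv stack)
    go (yes x-new) = searched x-new
      (searchLoop root (<-wellFounded _) (Inv.untouched inv x-new) (inv-mark x inv)
        (lookup∘update x col gray) tt (rep-mark x stack))

  empty : Memory
  empty _ = false

  counting : (x W : ℕ) → Config registerCount
  counting x W = file 0 0 0 0 0 x 0 W 0 0 0 0 0 (replicate 6 0) empty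

  Counted : (e x W : ℕ) → Set
  Counted e x W = ∃[ T ] ∃[ k ] T ≤ 1 + 3 * e × k ≤ e × x < 2 ^ k ×
    Exec (while (reg v#) countBit) (counting x W) T [] (counting 0 (W + k))

  -- The exponent `e` limits the number of halvings and serves as the measure of the recursion.
  countBits : ∀ e {x W} → x < 2 ^ e → W + e ≤ b → x < 2 ^ b → Counted e x W
  countBits e {zero} {W} _ _ _ = 1 , 0 , s≤s z≤n , z≤n , s≤s z≤n ,
    subst (λ W′ → Exec (while (reg v#) countBit) (counting 0 W) 1 [] (counting 0 W′))
      (sym (+-identityʳ W)) (while-false refl)
  countBits zero {suc x} (s≤s ()) _ _
  countBits (suc e) {x@(suc _)} {W} x< W+e≤b x<2^b =
    extend (countBits e {x / 2} {suc W} (/2-< {e = e} x<) (subst (_≤ b) (+-suc W e) W+e≤b)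
      (≤-<-trans (m/n≤m x 2) x<2^b))
    where
    extend : Counted e (x / 2) (suc W) → Counted (suc e) x W
    extend (T , k , T≤ , k≤ , half< , exec) = _ , suc k ,
      ≤-trans (s≤s (+-monoʳ-≤ 2 T≤)) (≤-reflexive (time e)) , s≤s k≤ , x<2^k+1 ,
      subst (λ W′ → Exec (while (reg v#) countBit) (counting x W) (suc (2 + T)) [] (counting 0 W′))
        (sym (+-suc W k))
        (while-true (λ ())
          (set-div refl (constant 2) refl (≤-<-trans (m/n≤m x 2) x<2^b) ⨾
           set-add refl (constant 1) (+-comm W 1) W+1<2^b)
          exec)
      where
      time : ∀ e → suc (2 + (1 + 3 * e)) ≡ 1 + 3 * suc e
      time = solve-∀
      W+1<2^b : suc W < 2 ^ b
      W+1<2^b = ≤-<-trans (≤-trans (s≤s (m≤m+n W e)) (≤-trans (≤-reflexive (sym (+-suc W e))) W+e≤b)) (n<2^n b)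
      x<2^k+1 : x < 2 ^ suc k
      x<2^k+1 = begin-strict
        x                    ≡⟨ m≡m%n+[m/n]*n x 2 ⟩
        x % 2 + x / 2 * 2    <⟨ +-monoˡ-< (x / 2 * 2) (m%n<n x 2) ⟩
        2 + x / 2 * 2        ≡⟨⟩
        suc (x / 2) * 2      ≤⟨ *-monoˡ-≤ 2 half< ⟩
        2 ^ k * 2            ≡⟨ *-comm (2 ^ k) 2 ⟩
        2 ^ suc k            ∎
        where open ≤-Reasoning

  Φ-initial : Φ (replicate n white) (λ _ → 0) ≤ edgeCount + n
  Φ-initial = begin
    Φ (replicate n white) (λ _ → 0)
      ≤⟨ Σ-mono (λ x → +-monoʳ-≤ (outdeg x)
           (≤-reflexive (cong unfinished (lookup-replicate x white)))) ⟩
    Σ[ (λ x → outdeg x + 1) ]        ≡⟨ Σ-+ outdeg (λ _ → 1) ⟩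
    edgeCount + Σ[ (λ (_ : Fin n) → 1) ]
      ≤⟨ +-monoʳ-≤ edgeCount (≤-trans (Σ-const {n} (λ _ → 1) 1 (λ _ → ≤-refl)) (≤-reflexive (*-identityʳ n))) ⟩
    edgeCount + n                    ∎
    where open ≤-Reasoning

  dfs-correct : ∀ e → n < 2 ^ e → e ≤ b → ∃[ t ]
    CarriesOutDFS dfs I adjacency w t (registerCount * b + M) ×
    t ≤ 5 + 3 * e + (20 * n + cost * (edgeCount + n))
  dfs-correct e n< e≤b = after (countBits e n< e≤b n<2^b)
    where
    Goal : Set
    Goal = ∃[ t ] CarriesOutDFS dfs I adjacency w t (registerCount * b + M) ×
      t ≤ 5 + 3 * e + (20 * n + cost * (edgeCount + n))

    roots : Consecutive 0 (allFin n)
    roots = consecutive-tabulate 0 id refl (λ _ → refl)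

    initially : Inv (replicate n white) [] (λ _ → 0) empty
    initially = record
      { untouched = λ _ → refl ; sound = λ () ; complete = λ ()
      ; bits = λ x → cong marked (sym (lookup-replicate x white)) }

    finally : ∀ {T W} → T ≤ 1 + 3 * e →
      Exec (while (reg v#) countBit) (counting n 0) T [] (counting 0 W) →
      Traversed (file 0 0 0 0 (nonempty (allFin n)) 0 (suc n) W 0 0 0 0 0 (replicate 6 0) empty)
        (initial (allFin n)) (rootBudget (Φ (replicate n white) (λ _ → 0)) (allFin n)) → Goal
    finally {T} T≤ exec traversed = _ ,
      (b , M , _ , _ , b≤w , ≤-refl ,
        (set size≡ n<2^b ⨾
         exec ⨾
         set-add size≡ (constant 1) (+-comm n 1) (≤-<-trans n<M M<2^b) ⨾
         test-exec roots ⨾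
         R.run) ,
        (allFin n , _ , _ , ↭-refl , R.steps)) ,
      (begin
        suc (T + suc (suc R.time))
          ≤⟨ s≤s (+-mono-≤ T≤ (s≤s (s≤s R.bound))) ⟩
        suc (1 + 3 * e + (3 + (20 * length (allFin n) + cost * Φ (replicate n white) (λ _ → 0))))
          ≤⟨ s≤s (+-monoʳ-≤ (1 + 3 * e) (+-monoʳ-≤ 3
               (+-mono-≤ (*-monoʳ-≤ 20 (≤-reflexive (List.length-tabulate {n = n} id)))
                 (*-monoʳ-≤ cost Φ-initial)))) ⟩
        suc (1 + 3 * e + (3 + (20 * n + cost * (edgeCount + n))))
          ≡⟨ lemma (3 * e) (20 * n + cost * (edgeCount + n)) ⟩
        5 + 3 * e + (20 * n + cost * (edgeCount + n)) ∎)
      where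
      open ≤-Reasoning
      module R = Traversed traversed
      lemma : ∀ a X → suc (1 + a + (3 + X)) ≡ 5 + a + X
      lemma = solve-∀

    after : Counted e n 0 → Goal
    after (_ , k , T≤ , k≤ , n<2^k , exec) =
      finally T≤ exec (searchRoots {next = λ _ → 0} roots initially (rep n<2^k (≤-trans k≤ e≤b) []))

-- The two graph representations

n≤2^⌈log₂n⌉ : ∀ n → n ≤ 2 ^ ⌈log₂ n ⌉
n≤2^⌈log₂n⌉ n = go n (<-wellFounded n)
  where
  go : ∀ n → Acc _<_ n → n ≤ 2 ^ ⌈log₂ n ⌉
  go 0 _ = z≤n
  go 1 _ = m^n>0 2 ⌈log₂ 1 ⌉
  go n@(suc (suc m)) (acc smaller) = begin
    n                              ≡⟨ ⌊n/2⌋+⌈n/2⌉≡n n ⟨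
    ⌊ n /2⌋ + h                    ≤⟨ +-mono-≤ (⌊n/2⌋≤⌈n/2⌉ n) (m≤m+n h 0) ⟩
    2 * h                          ≤⟨ *-monoʳ-≤ 2 (go h (smaller (⌈n/2⌉<n m))) ⟩
    2 * 2 ^ ⌈log₂ h ⌉              ≡⟨ cong (λ l → 2 * 2 ^ l) (⌈log₂⌈n/2⌉⌉≡⌈log₂n⌉∸1 n) ⟩
    2 ^ (1 + (⌈log₂ n ⌉ ∸ 1))      ≡⟨ cong (2 ^_) (m+[n∸m]≡n (⌈log₂⌉-mono-≤ (s≤s (s≤s (z≤n {m}))))) ⟩
    2 ^ ⌈log₂ n ⌉                  ∎
    where
    open ≤-Reasoning
    h = ⌈ n /2⌉

n<2^lg : ∀ n → n < 2 ^ lg n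
n<2^lg n = ≤-<-trans (n≤2^⌈log₂n⌉ n) (^-monoʳ-< 2 ≤-refl (n<1+n ⌈log₂ n ⌉))

lg≤1+n : ∀ n → lg n ≤ 1 + n
lg≤1+n n = s≤s (≤-trans (⌈log₂⌉-mono-≤ (<⇒≤ (n<2^n n))) (≤-reflexive (⌈log₂2^n⌉≡n n)))

-- The free bit 0, the n marks, and ⌊4m/5⌋ bits for the stack.
memoryBits : ℕ → ℕ → ℕ
memoryBits n m = suc n + 4 * m / 5

5*[/5]≤ : ∀ a → 5 * (a / 5) ≤ a
5*[/5]≤ a = ≤-trans (≤-reflexive (*-comm 5 (a / 5))) (m/n*n≤m a 5)

≤5*[/5]+4 : ∀ a → a ≤ 5 * (a / 5) + 4
≤5*[/5]+4 a = begin
  a                    ≡⟨ m≡m%n+[m/n]*n a 5 ⟩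
  a % 5 + a / 5 * 5    ≤⟨ +-monoˡ-≤ (a / 5 * 5) (s≤s⁻¹ (m%n<n a 5)) ⟩
  4 + a / 5 * 5        ≡⟨ trans (+-comm 4 _) (cong (_+ 4) (*-comm (a / 5) 5)) ⟩
  5 * (a / 5) + 4      ∎
  where open ≤-Reasoning

module _ (n m : ℕ) where
  private
    -- As `lg n` is 1 for n = 1, the factor has to be at least 14 for a block to fit into a
    -- register. It also exceeds 3, which suffices for addresses, as these are below N^3.
    b = 16 * lg n
    N = 2 ^ lg n

    N^ : ∀ k → N ^ k ≡ 2 ^ (k * lg n)
    N^ k = trans (^-*-assoc 2 (lg n) k) (cong (2 ^_) (*-comm (lg n) k))

    2≤N : 2 ≤ N
    2≤N = ^-monoʳ-≤ 2 (s≤s (z≤n {⌈log₂ n ⌉}))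

    N^3<2^b : N ^ 3 < 2 ^ b
    N^3<2^b = subst (_< 2 ^ b) (sym (N^ 3)) (^-monoʳ-< 2 ≤-refl (*-monoˡ-< (lg n) (≤ᵇ⇒≤ 4 16 tt)))

  14≤16*lg : 14 ≤ b
  14≤16*lg = ≤-trans (≤ᵇ⇒≤ 14 16 tt) (*-monoʳ-≤ 16 (s≤s (z≤n {⌈log₂ n ⌉})))

  lg≤16*lg : lg n ≤ b
  lg≤16*lg = m≤n*m (lg n) 16

  4*n<2^b : 4 * n < 2 ^ b
  4*n<2^b = ≤-<-trans (begin
    4 * n            ≤⟨ *-mono-≤ (*-mono-≤ 2≤N 2≤N) (<⇒≤ (n<2^lg n)) ⟩
    N * N * N        ≡⟨ cube N ⟩
    N ^ 3            ∎) N^3<2^b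
    where
    open ≤-Reasoning
    cube : ∀ N → N * N * N ≡ N * (N * (N * 1))
    cube = solve-∀

  memoryBits<2^b : m ≤ n * n → memoryBits n m < 2 ^ b
  memoryBits<2^b m≤ = ≤-<-trans (begin
    suc n + 4 * m / 5      
      ≤⟨ +-monoʳ-≤ (suc n) (*-cancelˡ-≤ 5 (≤-trans (5*[/5]≤ (4 * m)) (*-monoˡ-≤ m (≤ᵇ⇒≤ 4 5 tt)))) ⟩
    suc n + m              ≤⟨ +-mono-≤ (n<2^lg n) (≤-trans m≤ (*-mono-≤ (<⇒≤ (n<2^lg n)) (<⇒≤ (n<2^lg n)))) ⟩
    N + N * N              ≤⟨ +-monoˡ-≤ (N * N) (m≤m*n N N) ⟩
    N * N + N * N          ≡⟨ cong (N * N +_) (+-identityʳ (N * N)) ⟨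
    2 * (N * N)            ≤⟨ *-monoˡ-≤ (N * N) 2≤N ⟩
    N * (N * N)            ≡⟨ cong (λ k → N * (N * k)) (*-identityʳ N) ⟨
    N ^ 3                  ∎) N^3<2^b
    where
    open ≤-Reasoning
    instance
      N≢0 : NonZero N
      N≢0 = m^n≢0 2 (lg n)

  keys-fit : ∀ K → 2 * K ≤ 4 * m → 5 * suc n + 2 * K ≤ 5 * memoryBits n m + 4
  keys-fit K 2K≤ = begin
    5 * suc n + 2 * K                    ≤⟨ +-monoʳ-≤ (5 * suc n) (≤-trans 2K≤ (≤5*[/5]+4 (4 * m))) ⟩
    5 * suc n + (5 * (4 * m / 5) + 4)    ≡⟨ +-assoc (5 * suc n) _ 4 ⟨
    5 * suc n + 5 * (4 * m / 5) + 4      ≡⟨ cong (_+ 4) (*-distribˡ-+ 5 (suc n) (4 * m / 5)) ⟨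
    5 * memoryBits n m + 4               ∎
    where open ≤-Reasoning

  -- The 19 registers of 16 · lg n bits make 304 · lg n, and the free bit 0 adds at most one more
  -- `lg n`, which gives 305.
  space-bound : 5 * (registerCount * b + memoryBits n m) ≤ 5 * n + 4 * m + 5 * (305 * lg n)
  space-bound = begin
    5 * (19 * (16 * lg n) + (suc n + q))    ≡⟨ lemma₁ (lg n) n q ⟩
    1520 * lg n + 5 + (5 * n + 5 * q)
      ≤⟨ +-mono-≤ (+-monoʳ-≤ (1520 * lg n) (*-monoʳ-≤ 5 (s≤s (z≤n {⌈log₂ n ⌉}))))
           (+-monoʳ-≤ (5 * n) (5*[/5]≤ (4 * m))) ⟩
    1520 * lg n + 5 * lg n + (5 * n + 4 * m) ≡⟨ lemma₂ (lg n) (5 * n + 4 * m) ⟩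
    5 * n + 4 * m + 5 * (305 * lg n)        ∎
    where
    open ≤-Reasoning
    q = 4 * m / 5
    lemma₁ : ∀ l n q → 5 * (19 * (16 * l) + (suc n + q)) ≡ 1520 * l + 5 + (5 * n + 5 * q)
    lemma₁ = solve-∀
    lemma₂ : ∀ l X → 1520 * l + 5 * l + X ≡ X + 5 * (305 * l)
    lemma₂ = solve-∀

  time-bound : .{{_ : NonZero n}} → ∀ {arcs t} → arcs ≤ 2 * m →
    t ≤ 5 + 3 * lg n + (20 * n + 70 * (arcs + n)) → t ≤ 200 * (n + m)
  time-bound {arcs} {t} arcs≤ t≤ = begin
    t                                               ≤⟨ t≤ ⟩
    5 + 3 * lg n + (20 * n + 70 * (arcs + n))
      ≤⟨ +-mono-≤ (+-monoʳ-≤ 5 (*-monoʳ-≤ 3 (lg≤1+n n)))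
           (+-monoʳ-≤ (20 * n) (*-monoʳ-≤ 70 (+-monoˡ-≤ n arcs≤))) ⟩
    5 + 3 * (1 + n) + (20 * n + 70 * (2 * m + n))   ≡⟨ lemma₁ n m ⟩
    -- The constant is absorbed because there is at least one vertex.
    8 * 1 + (93 * n + 140 * m)                      ≤⟨ +-monoˡ-≤ _ (*-monoʳ-≤ 8 (>-nonZero⁻¹ n)) ⟩
    8 * n + (93 * n + 140 * m)                      ≡⟨ lemma₂ n m ⟩
    101 * n + 140 * m
      ≤⟨ +-mono-≤ (*-monoˡ-≤ n (≤ᵇ⇒≤ 101 200 tt)) (*-monoˡ-≤ m (≤ᵇ⇒≤ 140 200 tt)) ⟩
    200 * n + 200 * m                               ≡⟨ *-distribˡ-+ 200 n m ⟨
    200 * (n + m)                                   ∎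
    where
    open ≤-Reasoning
    lemma₁ : ∀ n m → 5 + 3 * (1 + n) + (20 * n + 70 * (2 * m + n)) ≡ 8 * 1 + (93 * n + 140 * m)
    lemma₁ = solve-∀
    lemma₂ : ∀ n m → 8 * n + (93 * n + 140 * m) ≡ 101 * n + 140 * m
    lemma₂ = solve-∀

carriesOut : ∀ {S n m w} .{{_ : NonZero n}} (F : Interface S) (D : DirectedGraph n) (I : Input S) →
  m ≤ n * n → DirectedGraph.edgeCount D ≤ 2 * m → 16 * lg n ≤ w →
  Correct F D I w (16 * lg n) (memoryBits n m) →
  ∃[ t ] ∃[ s ]
    CarriesOutDFS (Traversal.dfs F) I (DirectedGraph.adjacency D) w t s
    × t ≤ 200 * (n + m)
    × 5 * s ≤ 5 * n + 4 * m + 5 * (305 * lg n)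
carriesOut {n = n} {m} {w} F D I m≤ arcs≤ w≥ correct =
  after (dfs-correct (lg n) (n<2^lg n) (lg≤16*lg n m))
  where
  open SearchExecution F D I w (16 * lg n) (memoryBits n m) w≥ (14≤16*lg n m) (memoryBits<2^b n m m≤) correct
  after : _ → _
  after (t , carries , t≤) = t , _ , carries , time-bound n m arcs≤ t≤ , space-bound n m

-- Interfaces for directed and undirected inputs

toFin-toℕ : ∀ {d} (i : Fin d) → toFin d (toℕ i) ≡ just i
toFin-toℕ {d} i with toℕ i <? d
... | yes i<d = cong just (Fin.fromℕ<-toℕ i i<d)
... | no i≮d  = contradiction (Fin.toℕ<n i) i≮d

onVertices-label : ∀ {n} (f : Fin n → ℕ) u → onVertices f (label u) ≡ just (f u)
onVertices-label f u rewrite toFin-toℕ u = refl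

onEntries-label : ∀ {n} (d : Fin n → ℕ) (f : (u : Fin n) → Fin (d u) → ℕ) u i →
  onEntries d f (label u) (toℕ i) ≡ just (f u i)
onEntries-label d f u i rewrite toFin-toℕ u | toFin-toℕ i = refl

directedInterface : Interface directed
directedInterface = record
  { outdeg = DAccess₁.outdeg
  ; outhead = DAccess₂.outhead ; inhead = DAccess₂.inhead
  ; outmate = DAccess₂.outmate ; inmate = DAccess₂.inmate
  ; key    = d# := access₁ DAccess₁.indeg (reg u#) ⨾ d# := op add (reg d#) (reg d#)
  ; encode = x# := val (reg p#)
  ; decode = p# := val (reg x#) }

-- The child is not the parent, so the positions smaller and larger than j are
-- numbered consecutively.
undirectedInterface : Interface undirected
undirectedInterface = record
  { outdeg = UAccess₁.deg
  ; outhead = UAccess₂.head ; inhead = UAccess₂.head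
  ; outmate = UAccess₂.mate ; inmate = UAccess₂.mate
  ; key    = d# := access₁ UAccess₁.deg (reg u#)
  ; encode = y# := op Op.lt (reg j#) (reg p#) ⨾ x# := op sub (reg p#) (reg y#)
  ; decode =
      y# := op Op.lt (reg x#) (reg j#) ⨾
      x# := op add (reg x#) (const 1) ⨾
      p# := op sub (reg x#) (reg y#) }

-- For p ≠ j this is the rank of `p` among the positions other than `j`.
skipOver : (p j : ℕ) → ℕ
skipOver p j = p ∸ fromBool (j <ᵇ p)

skipOver-< : ∀ {p j} → j < p → suc (skipOver p j) ≡ p
skipOver-< {suc p} {j} j<p rewrite <ᵇ-true j<p = refl

skipOver-≥ : ∀ {p j} → p ≤ j → skipOver p j ≡ p
skipOver-≥ {p} {j} p≤j rewrite <ᵇ-false p≤j = refl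

module _ {n : ℕ} (G : DirectedGraph n) {w : ℕ} (w≥ : 16 * lg n ≤ w) where
  private
    module G = DirectedGraph G
    I = directedInput G
    b = 16 * lg n
    M = memoryBits n G.edgeCount
    small-M = memoryBits<2^b n G.edgeCount (edgeCount≤n*n G)

  open StackExecution I n w b M w≥ (14≤16*lg n G.edgeCount) small-M

  directed-correct : Correct directedInterface G I w b M
  directed-correct = record
    { size≡    = refl
    ; outdeg≡  = onVertices-label G.outdeg
    ; outhead≡ = onEntries-label G.outdeg (λ u i → label (G.outhead u i))
    ; inhead≡  = onEntries-label G.indeg (λ v j → label (G.inhead v j))
    ; outmate≡ = onEntries-label G.outdeg (λ u i → toℕ (G.outmate u i))
    ; inmate≡  = onEntries-label G.indeg (λ v j → toℕ (G.inmate v j))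
    ; keyOf    = λ u → G.indeg u + G.indeg u
    ; payload  = λ p j → p
    ; key<     = key<
    ; payload≤ = λ p j → ≤-refl
    -- A vertex with an inneighbor has indegree at least 1; adding this to `suc (toℕ p) ≤ indeg u`
    -- gives the strict bound by twice the indegree.
    ; payload< = λ u p i _ → +-mono-≤ (≤-trans (s≤s z≤n) (Fin.toℕ<n p)) (Fin.toℕ<n p)
    ; enough   = keys-fit n G.edgeCount Σ[ (λ u → G.indeg u + G.indeg u) ] keys
    ; key-exec = λ u → _ , ≤ᵇ⇒≤ 2 5 tt ,
        (set-access₁ refl (onVertices-label G.indeg u) (≤-<-trans (m≤m+n _ _) (indeg< u)) ⨾
         set-add refl refl refl (indeg< u))
    ; encode-exec = λ p< → _ , _ , ≤ᵇ⇒≤ 1 5 tt , set refl p<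
    ; decode-exec = λ u p i _ → _ , _ , _ , ≤ᵇ⇒≤ 1 5 tt ,
        set refl (≤-<-trans (<⇒≤ (Fin.toℕ<n p)) (≤-<-trans (m≤m+n _ _) (indeg< u))) }
    where
    key< : ∀ u → G.indeg u + G.indeg u + (G.indeg u + G.indeg u) < 2 ^ b
    key< u = ≤-<-trans (≤-trans (≤-reflexive (quadruple (G.indeg u))) (*-monoʳ-≤ 4 (indeg≤n G u)))
      (4*n<2^b n G.edgeCount)
      where
      quadruple : ∀ x → x + x + (x + x) ≡ 4 * x
      quadruple = solve-∀
    indeg< : ∀ u → G.indeg u + G.indeg u < 2 ^ b
    indeg< u = ≤-<-trans (m≤m+n _ _) (key< u)
    keys : 2 * Σ[ (λ u → G.indeg u + G.indeg u) ] ≤ 4 * G.edgeCount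
    keys = begin
      2 * Σ[ (λ u → G.indeg u + G.indeg u) ]   ≡⟨ cong (2 *_) (Σ-+ G.indeg G.indeg) ⟩
      2 * (Σ[ G.indeg ] + Σ[ G.indeg ])        ≡⟨ lemma Σ[ G.indeg ] ⟩
      4 * Σ[ G.indeg ]                         ≤⟨ *-monoʳ-≤ 4 (Σindeg≤edgeCount G) ⟩
      4 * G.edgeCount                          ∎
      where
      open ≤-Reasoning
      lemma : ∀ x → 2 * (x + x) ≡ 4 * x
      lemma = solve-∀

module _ {n : ℕ} (G : UndirectedGraph n) {w : ℕ} (w≥ : 16 * lg n ≤ w) where
  private
    module G = UndirectedGraph G
    I = undirectedInput G
    b = 16 * lg n
    M = memoryBits n G.edgeCount

  undirected-edgeCount≤n*n : G.edgeCount ≤ n * n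
  undirected-edgeCount≤n*n = Σ-const _ n λ u → ≤-trans
    (List.length-filter (λ i → u Fin.<? G.head u i) (allFin (G.deg u)))
    (≤-trans (≤-reflexive (List.length-tabulate {n = G.deg u} id)) (outdeg≤n (bidirected G) u))

  open StackExecution I n w b M w≥ (14≤16*lg n G.edgeCount)
    (memoryBits<2^b n G.edgeCount undirected-edgeCount≤n*n)

  undirected-correct : Correct undirectedInterface (bidirected G) I w b M
  undirected-correct = record
    { size≡    = refl
    ; outdeg≡  = onVertices-label G.deg
    ; outhead≡ = heads
    ; inhead≡  = heads
    ; outmate≡ = mates
    ; inmate≡  = mates
    ; keyOf    = G.deg
    ; payload  = skipOver
    ; key<     = key<
    ; payload≤ = λ p j → m∸n≤m p (fromBool (j <ᵇ p))
    ; payload< = payload<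
    ; enough   = keys-fit n G.edgeCount Σ[ G.deg ]
        (≤-trans (*-monoʳ-≤ 2 (Σdeg≤2*edgeCount G)) (≤-reflexive (sym (*-assoc 2 2 G.edgeCount))))
    ; key-exec = λ u → _ , ≤ᵇ⇒≤ 1 5 tt , set-access₁ refl (onVertices-label G.deg u) (deg< u)
    ; encode-exec = encode-exec
    ; decode-exec = decode-exec }
    where
    heads : ∀ u i → Input.access₂ I UAccess₂.head (label u) (toℕ i) ≡ just (label (G.head u i))
    heads = onEntries-label G.deg (λ u i → label (G.head u i))
    mates : ∀ u i → Input.access₂ I UAccess₂.mate (label u) (toℕ i) ≡ just (toℕ (G.mate u i))
    mates = onEntries-label G.deg (λ u i → toℕ (G.mate u i))
    key< : ∀ u → G.deg u + G.deg u < 2 ^ b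
    key< u = ≤-<-trans (+-mono-≤ (outdeg≤n (bidirected G) u) (≤-trans (outdeg≤n (bidirected G) u) (m≤m+n n _)))
      (4*n<2^b n G.edgeCount)
    deg< : ∀ u → G.deg u < 2 ^ b
    deg< u = ≤-<-trans (m≤m+n _ _) (key< u)
    positions-differ : ∀ u {p i} → G.head u p ≢ G.head u i → toℕ p ≢ toℕ i
    positions-differ u differ eq = differ (cong (G.head u) (Fin.toℕ-injective eq))

    payload< : ∀ u p i → G.head u p ≢ G.head u i → suc (skipOver (toℕ p) (toℕ i)) < G.deg u
    payload< u p i differ with <-cmp (toℕ i) (toℕ p)
    ... | tri< i<p _ _ = subst (_< G.deg u) (sym (skipOver-< i<p)) (Fin.toℕ<n p)
    ... | tri≈ _ i≡p _ = contradiction (sym i≡p) (positions-differ u differ)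
    ... | tri> _ _ p<i = ≤-<-trans (subst (λ x → suc x ≤ toℕ i) (sym (skipOver-≥ (<⇒≤ p<i))) p<i) (Fin.toℕ<n i)

    encode-exec : ∀ {u p j r t v sp W d x y A C a μ} → p < 2 ^ b → ∃[ T ] ∃[ y′ ] T ≤ 5 ×
      Exec (Interface.encode undirectedInterface) (file u p j r t v sp W d x y A C a μ) T []
        (file u p j r t v sp W d (skipOver p j) y′ A C a μ)
    encode-exec {p = p} {j} p< = _ , _ , ≤ᵇ⇒≤ 2 5 tt ,
      (set-lt refl refl ⨾ set-sub refl refl (m+[n∸m]≡n below) p<)
      where
      below : fromBool (j <ᵇ p) ≤ p
      below with <-≤-connex j p
      ... | inj₁ j<p rewrite <ᵇ-true j<p  = ≤-trans (s≤s z≤n) j<p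
      ... | inj₂ p≤j rewrite <ᵇ-false p≤j = z≤n

    -- The rank x is less than the position j of the child exactly if p is. Hence p is x + 1 in one
    -- case and x in the other, computed as x + 1 minus the truth value of x < j.
    decode-exec : ∀ u p i {p₀ r t v sp W d y A C a μ} → G.head u p ≢ G.head u i →
      ∃[ T ] ∃[ x′ ] ∃[ y′ ] T ≤ 5 ×
      Exec (Interface.decode undirectedInterface)
        (file (label u) p₀ (toℕ i) r t v sp W d (skipOver (toℕ p) (toℕ i)) y A C a μ) T []
        (file (label u) (toℕ p) (toℕ i) r t v sp W d x′ y′ A C a μ)
    decode-exec u p i differ with <-cmp (toℕ i) (toℕ p)
    ... | tri< i<p _ _ = _ , _ , _ , ≤ᵇ⇒≤ 3 5 tt ,
      (set-lt-no refl refl (s≤s⁻¹ (subst (toℕ i <_) (sym (skipOver-< i<p)) i<p)) ⨾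
       set-add refl (constant 1) (trans (+-comm _ 1) (skipOver-< i<p)) p<2^b ⨾
       set-sub refl refl refl p<2^b)
      where
      p<2^b : toℕ p < 2 ^ b
      p<2^b = <-trans (Fin.toℕ<n p) (deg< u)
    ... | tri≈ _ i≡p _ = contradiction (sym i≡p) (positions-differ u differ)
    ... | tri> _ _ p<i = _ , _ , _ , ≤ᵇ⇒≤ 3 5 tt ,
      (set-lt-yes refl refl (subst (_< toℕ i) (sym (skipOver-≥ (<⇒≤ p<i))) p<i) ⨾
       set-add refl (constant 1) (trans (+-comm _ 1) (cong suc (skipOver-≥ (<⇒≤ p<i)))) p+1<2^b ⨾
       set-sub refl refl refl p+1<2^b)
      where
      p+1<2^b : suc (toℕ p) < 2 ^ b
      p+1<2^b = ≤-<-trans (Fin.toℕ<n p) (deg< u)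

theorem4p2 : (∃[ k ] Σ[ P ∈ Program undirected k ] ∃[ c₀ ] ∃[ c₁ ] ∃[ c₂ ]
    (∀ (n : ℕ) .{{_ : NonZero n}} (G : UndirectedGraph n) →
    let m = UndirectedGraph.edgeCount G in
    ∀ (w : ℕ) → c₀ * lg n ≤ w →
    ∃[ t ] ∃[ s ]
    CarriesOutDFS P (undirectedInput G) (UndirectedGraph.adjacency G) w t s
    × t ≤ c₁ * (n + m)
    × 5 * s ≤ 5 * n + 4 * m + 5 * (c₂ * lg n)))
    ×
    (∃[ k ] Σ[ P ∈ Program directed k ] ∃[ c₀ ] ∃[ c₁ ] ∃[ c₂ ]
    (∀ (n : ℕ) .{{_ : NonZero n}} (G : DirectedGraph n) →
    let m = DirectedGraph.edgeCount G in
    ∀ (w : ℕ) → c₀ * lg n ≤ w →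
    ∃[ t ] ∃[ s ]
    CarriesOutDFS P (directedInput G) (DirectedGraph.adjacency G) w t s
    × t ≤ c₁ * (n + m)
    × 5 * s ≤ 5 * n + 4 * m + 5 * (c₂ * lg n)))
theorem4p2 =
  (registerCount , Traversal.dfs undirectedInterface , 16 , 200 , 305 , λ n G w w≥ →
    carriesOut undirectedInterface (bidirected G) (undirectedInput G) (undirected-edgeCount≤n*n G w≥)
      (Σdeg≤2*edgeCount G) w≥ (undirected-correct G w≥)) ,
  (registerCount , Traversal.dfs directedInterface , 16 , 200 , 305 , λ n G w w≥ →
    carriesOut directedInterface G (directedInput G) (edgeCount≤n*n G)
      (m≤n*m (DirectedGraph.edgeCount G) 2) w≥ (directed-correct G w≥))
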